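{- Let $(q_k)_{k\ge1}$ be a sequence of integers with $q_k \ge 2$ for every $k \in \mathbb{N}$ and $\liminf_{k\to\infty} q_k/k > 3$. Then there exists a constant $C$ such that the following holds. For every $n \in \mathbb{N}$ and every collection $\mathcal{A}$ of hyperplanes in $Q := [q_1]\times\cdots\times[q_n]$ whose union is $Q$, either two distinct hyperplanes of $\mathcal{A}$ are parallel, or there exists $A \in \mathcal{A}$ with $F(A) \subseteq [C]$.
   Context: $[m] = \{1,\dots,m\}$. For finite sets $S_1,\dots,S_n$, a hyperplane in $Q = S_1\times\cdots\times S_n$ is a set $A = A_1\times\cdots\times A_n$ where each $A_k$ is either $S_k$ or a singleton subset of $S_k$. Its set of fixed coordinates is $F(A) = \{k : A_k \text{ is a singleton}\}$. Two hyperplanes $A, A'$ are parallel if $F(A) = F(A')$. -}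

module Defs where

open import Data.Fin using (Fin; toℕ)
open import Data.Fin.Subset using (Subset; ⊤; ⁅_⁆) renaming (_∈_ to _∈ˢ_)
open import Data.Integer using (+_)
open import Data.List using (List)
open import Data.List.Relation.Unary.Any using (Any)
open import Data.Nat using (ℕ; suc; _≤_)
open import Data.Product using (∃; ∃-syntax; _×_)
open import Data.Rational as ℚ using (ℚ)
open import Data.Sum using (_⊎_)
open import Level using (0ℓ)
open import Relation.Binary.PropositionalEquality using (_≡_)
open import Relation.Unary using (Pred; _∈_; _≐_)

-- liminf a = sup_N inf_{k ≥ N} a k may be irrational or infinite, so only its
-- strict comparison with a rational is defined.  An infimum exceeds c iff some
-- rational r > c is a lower bound; a supremum exceeds c iff some member does.

_<inf_from_ : ℚ → (ℕ → ℚ) → ℕ → Set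
c <inf a from N = ∃[ r ] c ℚ.< r × (∀ k → N ≤ k → r ℚ.≤ a k)

_<liminf_ : ℚ → (ℕ → ℚ) → Set
c <liminf a = ∃[ N ] c <inf a from N

-- Sequences (q k) with k ≥ 1 are functions on ℕ whose value at 0 is never used.
-- The ratio q k / k is therefore listed from k = 1 on, which leaves its liminf
-- unchanged.

ratio : (ℕ → ℕ) → ℕ → ℚ
ratio q j = + q (suc j) ℚ./ suc j

-- Coordinates are 1, …, n, whereas toℕ counts from 0.

index : ∀ {n} → Fin n → ℕ
index k = suc (toℕ k)

[1‥_] : ∀ {n} → ℕ → Pred (Fin n) 0ℓ
[1‥ C ] k = index k ≤ C

sizes : (ℕ → ℕ) → (n : ℕ) → Fin n → ℕ
sizes q n k = q (index k)

Point : ∀ {n} → (Fin n → ℕ) → Set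
Point {n} s = (k : Fin n) → Fin (s k)

IsSingleton : ∀ {m} → Subset m → Set
IsSingleton p = ∃ λ x → p ≡ ⁅ x ⁆

record Hyperplane {n : ℕ} (s : Fin n → ℕ) : Set where
  field
    side        : (k : Fin n) → Subset (s k)
    full⊎single : (k : Fin n) → side k ≡ ⊤ ⊎ IsSingleton (side k)

open Hyperplane public

module _ {n : ℕ} {s : Fin n → ℕ} where

  ⟦_⟧ : Hyperplane s → Pred (Point s) 0ℓ
  ⟦ A ⟧ x = ∀ k → x k ∈ˢ side A k

  F : Hyperplane s → Pred (Fin n) 0ℓ
  F A k = IsSingleton (side A k)

  _≈_ : Hyperplane s → Hyperplane s → Set
  A ≈ B = ⟦ A ⟧ ≐ ⟦ B ⟧

  Parallel : Hyperplane s → Hyperplane s → Set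
  Parallel A B = F A ≐ F B

  -- There are finitely many hyperplanes, so a collection is a list; order and
  -- repetitions are immaterial because hyperplanes are compared by _≈_.
  Covers : List (Hyperplane s) → Set
  Covers 𝒜 = ∀ x → Any (λ A → x ∈ ⟦ A ⟧) 𝒜

{-# OPTIONS --safe #-}
module Submission where

-- The coordinates of an uncovered point are chosen greedily.  A pair of planes with the
-- same last fixed coordinate k gets the weight q_k⁻² ∏ c_i over the earlier coordinates i
-- fixed by either plane, where c_i = 1 / (q_i (1 - δ)), and other pairs get weight 0; the
-- energy of a collection is the sum of the weights of its pairs.  As long as the energy
-- is at most δ², the planes whose only remaining fixed coordinate is the next one forbid
-- at most a proportion δ of its values, and some other value does not increase the
-- energy, by averaging.  So a cover has energy more than δ².
-- If no two planes are parallel and every plane has its last fixed coordinate beyond C,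
-- the energy is at most ∑_{k > C} q_k⁻² ∏_{i < k} (1 + 3 c_i).  Since 3 c_i ≤ (1 - δ) / i
-- for large i, the product is O(k^{1-δ}), and the sum is at most δ² for large C.

open import Defs
open import Algebra.Bundles using (CommutativeRing)
open import Data.Bool using (Bool; true; false; _∨_)
open import Data.Bool.Properties using () renaming (_≟_ to _≟ᵇ_)
open import Data.Empty using (⊥-elim)
open import Data.Fin using (Fin; zero; suc; toℕ; fromℕ<)
import Data.Fin.Properties as Finₚ
open import Data.Fin.Subset using (Subset; inside; outside; ∣_∣; ⁅_⁆) renaming (_∈_ to _∈ˢ_)
open import Data.Fin.Subset.Properties using (∈⊤; x∈⁅x⁆; x∈⁅y⁆⇒x≡y; ∣⊤∣≡n; ∣⁅x⁆∣≡1)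
open import Data.Integer using (+_)
import Data.Integer as ℤ
import Data.Integer.Properties as ℤₚ
open import Data.List using (List; []; _∷_; _++_; map; mapMaybe; filter; allFin; length)
open import Data.List.Membership.Propositional using (find; lose) renaming (_∈_ to _∈ˡ_)
open import Data.List.Membership.Propositional.Properties
  using (∈-++⁺ˡ; ∈-++⁺ʳ; ∈-map⁺; ∈-map⁻; ∈-filter⁺; ∈-filter⁻)
open import Data.List.Properties using (length-tabulate)
open import Data.List.Relation.Unary.All using (All; []; _∷_)
open import Data.List.Relation.Unary.Any using (Any; here; there; any?)
open import Data.List.Relation.Unary.Unique.Propositional using (Unique; []; _∷_)
open import Data.List.Relation.Unary.Unique.Propositional.Properties using (allFin⁺)
open import Data.Maybe using (Maybe; just; nothing; is-just; Is-just; fromMaybe)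
import Data.Maybe.Relation.Unary.All as Maybe
import Data.Maybe.Relation.Unary.Any as MaybeAny
open import Data.Nat using (ℕ; zero; suc; _≤_; z≤n; s≤s)
import Data.Nat as ℕ
import Data.Nat.Properties as ℕₚ
import Data.Nat.Solver
open import Data.Product using (∃-syntax; _×_; _,_; proj₁; proj₂)
open import Data.Rational
  using (ℚ; 0ℚ; 1ℚ; _+_; _*_; -_; _-_; 1/_; _/_; ↥_; ↧_; ↧ₙ_; nonNegative; positive)
  renaming (_≤_ to _≤ℚ_; _<_ to _<ℚ_)
import Data.Rational.Properties as ℚₚ
open import Data.Rational.Solver using (module +-*-Solver)
open import Data.Rational.Unnormalised using (mkℚᵘ)
import Data.Rational.Unnormalised.Properties as ℚᵘₚ
open import Data.Sum using (_⊎_; inj₁; inj₂)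
import Data.Vec as Vec
open import Data.Vec.Properties using (lookup∘tabulate; ≡-dec)
open import Function using (_∘_; id)
open import Relation.Binary.PropositionalEquality
  using (_≡_; _≢_; refl; sym; trans; cong; cong₂; subst; module ≡-Reasoning)
open import Relation.Nullary using (¬_; Dec; yes; no; contradiction; ¬?; _×-dec_)
open import Relation.Nullary.Decidable using (decidable-stable)
open import Relation.Unary using (Decidable; _⊆_)
open import Algebra.Properties.Semiring.Mult (CommutativeRing.semiring ℚₚ.+-*-commutativeRing)
  using (×-homo-+; ×1-homo-*) renaming (_×_ to _·_)
open +-*-Solver using (solve; _:=_; _:+_; _:*_; _:-_; con)
open Data.Nat.Solver.+-*-Solver using ()
  renaming (solve to solveℕ; _:=_ to _≔_; _:+_ to _⊕_; _:*_ to _⊛_; con to conℕ)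

private
  variable
    n : ℕ
    A B : Set
    p q r p′ : ℚ

-- Inequalities between rationals

*-mono-≤ : 0ℚ ≤ℚ p → 0ℚ ≤ℚ q → p ≤ℚ p′ → r ≤ℚ q → p * r ≤ℚ p′ * q
*-mono-≤ {p} {q} 0≤p 0≤q p≤p′ r≤q = ℚₚ.≤-trans
  (ℚₚ.*-monoˡ-≤-nonNeg p {{nonNegative 0≤p}} r≤q)
  (ℚₚ.*-monoʳ-≤-nonNeg q {{nonNegative 0≤q}} p≤p′)

*-monoˡ-≤ : ∀ r → 0ℚ ≤ℚ r → p ≤ℚ q → p * r ≤ℚ q * r
*-monoˡ-≤ r 0≤r = ℚₚ.*-monoʳ-≤-nonNeg r {{nonNegative 0≤r}}

*-monoʳ-≤ : ∀ r → 0ℚ ≤ℚ r → p ≤ℚ q → r * p ≤ℚ r * q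
*-monoʳ-≤ r 0≤r = ℚₚ.*-monoˡ-≤-nonNeg r {{nonNegative 0≤r}}

0≤+ : 0ℚ ≤ℚ p → 0ℚ ≤ℚ q → 0ℚ ≤ℚ p + q
0≤+ 0≤p 0≤q = ℚₚ.≤-trans (ℚₚ.≤-reflexive (sym (ℚₚ.+-identityˡ 0ℚ))) (ℚₚ.+-mono-≤ 0≤p 0≤q)

0≤* : 0ℚ ≤ℚ p → 0ℚ ≤ℚ q → 0ℚ ≤ℚ p * q
0≤* {p} {q} 0≤p 0≤q =
  ℚₚ.≤-trans (ℚₚ.≤-reflexive (sym (ℚₚ.*-zeroʳ p))) (*-monoʳ-≤ p 0≤p 0≤q)

0≤1 : 0ℚ ≤ℚ 1ℚ
0≤1 = ℚₚ.nonNegative⁻¹ 1ℚ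

p≤p+q : 0ℚ ≤ℚ q → p ≤ℚ p + q
p≤p+q {q} {p} 0≤q =
  ℚₚ.≤-trans (ℚₚ.≤-reflexive (sym (ℚₚ.+-identityʳ p))) (ℚₚ.+-monoʳ-≤ p 0≤q)

p≤q+p : 0ℚ ≤ℚ q → p ≤ℚ q + p
p≤q+p {q} {p} 0≤q = ℚₚ.≤-trans (p≤p+q 0≤q) (ℚₚ.≤-reflexive (ℚₚ.+-comm p q))

+-cancelʳ-≤ : ∀ r → p + r ≤ℚ q + r → p ≤ℚ q
+-cancelʳ-≤ {p} {q} r p+r≤q+r = begin
  p              ≡⟨ solve 2 (λ p r → p := (p :+ r) :- r) refl p r ⟩
  (p + r) - r    ≤⟨ ℚₚ.+-monoˡ-≤ (- r) p+r≤q+r ⟩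
  (q + r) - r    ≡⟨ solve 2 (λ p r → (p :+ r) :- r := p) refl q r ⟩
  q              ∎
  where open ℚₚ.≤-Reasoning

<⇒≱ : p <ℚ q → ¬ (q ≤ℚ p)
<⇒≱ p<q q≤p = ℚₚ.<-irrefl refl (ℚₚ.<-≤-trans p<q q≤p)

ι : ℕ → ℚ
ι n = n · 1ℚ

0≤ι : ∀ n → 0ℚ ≤ℚ ι n
0≤ι zero    = ℚₚ.≤-refl
0≤ι (suc n) = 0≤+ 0≤1 (0≤ι n)

-- Sums over lists

∑ : List A → (A → ℚ) → ℚ
∑ []       f = 0ℚ
∑ (x ∷ xs) f = f x + ∑ xs f

∑-mono-∈ : ∀ (xs : List A) {f g : A → ℚ} → (∀ {x} → x ∈ˡ xs → f x ≤ℚ g x) → ∑ xs f ≤ℚ ∑ xs g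
∑-mono-∈ []       f≤g = ℚₚ.≤-refl
∑-mono-∈ (x ∷ xs) f≤g = ℚₚ.+-mono-≤ (f≤g (here refl)) (∑-mono-∈ xs (f≤g ∘ there))

∑-mono : ∀ (xs : List A) {f g : A → ℚ} → (∀ x → f x ≤ℚ g x) → ∑ xs f ≤ℚ ∑ xs g
∑-mono xs f≤g = ∑-mono-∈ xs (λ {x} _ → f≤g x)

∑-cong : ∀ (xs : List A) {f g : A → ℚ} → (∀ x → f x ≡ g x) → ∑ xs f ≡ ∑ xs g
∑-cong []       f≡g = refl
∑-cong (x ∷ xs) f≡g = cong₂ _+_ (f≡g x) (∑-cong xs f≡g)

∑-nonneg : ∀ (xs : List A) {f : A → ℚ} → (∀ x → 0ℚ ≤ℚ f x) → 0ℚ ≤ℚ ∑ xs f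
∑-nonneg []       0≤f = ℚₚ.≤-refl
∑-nonneg (x ∷ xs) 0≤f = 0≤+ (0≤f x) (∑-nonneg xs 0≤f)

∑-zero : ∀ (xs : List A) → ∑ xs (λ _ → 0ℚ) ≡ 0ℚ
∑-zero []       = refl
∑-zero (x ∷ xs) = trans (ℚₚ.+-identityˡ _) (∑-zero xs)

∑-+ : ∀ (xs : List A) (f g : A → ℚ) → ∑ xs (λ x → f x + g x) ≡ ∑ xs f + ∑ xs g
∑-+ []       f g = refl
∑-+ (x ∷ xs) f g = trans (cong (λ z → f x + g x + z) (∑-+ xs f g))
  (solve 4 (λ a b c d → (a :+ b) :+ (c :+ d) := (a :+ c) :+ (b :+ d)) refl (f x) (g x) (∑ xs f) (∑ xs g))

∑-*ˡ : ∀ (xs : List A) c (f : A → ℚ) → ∑ xs (λ x → c * f x) ≡ c * ∑ xs f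
∑-*ˡ []       c f = sym (ℚₚ.*-zeroʳ c)
∑-*ˡ (x ∷ xs) c f = trans (cong (λ z → c * f x + z) (∑-*ˡ xs c f)) (sym (ℚₚ.*-distribˡ-+ c _ _))

∑-*ʳ : ∀ (xs : List A) c (f : A → ℚ) → ∑ xs (λ x → f x * c) ≡ ∑ xs f * c
∑-*ʳ xs c f =
  trans (∑-cong xs (λ x → ℚₚ.*-comm (f x) c)) (trans (∑-*ˡ xs c f) (ℚₚ.*-comm c _))

∑-comm : ∀ (xs : List A) (ys : List B) (f : A → B → ℚ) →
  ∑ xs (λ x → ∑ ys (f x)) ≡ ∑ ys (λ y → ∑ xs (λ x → f x y))
∑-comm []       ys f = sym (∑-zero ys)
∑-comm (x ∷ xs) ys f =
  trans (cong (λ z → ∑ ys (f x) + z) (∑-comm xs ys f)) (sym (∑-+ ys (f x) (λ y → ∑ xs (λ x → f x y))))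

∑-map : ∀ (g : A → B) xs (f : B → ℚ) → ∑ (map g xs) f ≡ ∑ xs (f ∘ g)
∑-map g []       f = refl
∑-map g (x ∷ xs) f = cong (λ z → f (g x) + z) (∑-map g xs f)

∑-++ : ∀ (xs ys : List A) f → ∑ (xs ++ ys) f ≡ ∑ xs f + ∑ ys f
∑-++ []       ys f = sym (ℚₚ.+-identityˡ _)
∑-++ (x ∷ xs) ys f = trans (cong (λ z → f x + z) (∑-++ xs ys f)) (sym (ℚₚ.+-assoc (f x) _ _))

∑-∈-≤ : ∀ {xs : List A} {x} {f : A → ℚ} → (∀ x → 0ℚ ≤ℚ f x) → x ∈ˡ xs → f x ≤ℚ ∑ xs f
∑-∈-≤ {xs = _ ∷ xs} 0≤f (here refl)        = p≤p+q (∑-nonneg xs 0≤f)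
∑-∈-≤ {xs = y ∷ _}  0≤f (there x∈xs) = ℚₚ.≤-trans (∑-∈-≤ 0≤f x∈xs) (p≤q+p (0≤f y))

∑-1 : ∀ (xs : List A) → ∑ xs (λ _ → 1ℚ) ≡ ι (length xs)
∑-1 []       = refl
∑-1 (x ∷ xs) = cong (λ z → 1ℚ + z) (∑-1 xs)

𝟙 : ∀ {P : Set} → Dec P → ℚ
𝟙 (yes _) = 1ℚ
𝟙 (no _)  = 0ℚ

𝟙-nonneg : ∀ {P : Set} (P? : Dec P) → 0ℚ ≤ℚ 𝟙 P?
𝟙-nonneg (yes _) = 0≤1
𝟙-nonneg (no _)  = ℚₚ.≤-refl

𝟙≤1 : ∀ {P : Set} (P? : Dec P) → 𝟙 P? ≤ℚ 1ℚ
𝟙≤1 (yes _) = ℚₚ.≤-refl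
𝟙≤1 (no _)  = 0≤1

∑-filter : ∀ {P : A → Set} (P? : Decidable P) xs (f : A → ℚ) →
  ∑ (filter P? xs) f ≡ ∑ xs (λ x → 𝟙 (P? x) * f x)
∑-filter P? []       f = refl
∑-filter P? (x ∷ xs) f with P? x
... | yes _ = cong₂ _+_ (sym (ℚₚ.*-identityˡ (f x))) (∑-filter P? xs f)
... | no _  = trans (∑-filter P? xs f)
  (sym (trans (cong (_+ _) (ℚₚ.*-zeroˡ (f x))) (ℚₚ.+-identityˡ _)))

∑-𝟙-unique : ∀ {P : A → Set} (P? : Decidable P) → (∀ {x y} → P x → P y → x ≡ y) →
  ∀ {xs} → Unique xs → ∑ xs (λ x → 𝟙 (P? x)) ≤ℚ 1ℚ
∑-𝟙-unique         P? P-unique []         = 0≤1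
∑-𝟙-unique {P = P} P? P-unique {x ∷ xs} (x∉xs ∷ xs!) with P? x
... | no _   = ℚₚ.≤-trans (ℚₚ.≤-reflexive (ℚₚ.+-identityˡ _)) (∑-𝟙-unique P? P-unique xs!)
... | yes Px = ℚₚ.≤-reflexive (trans (cong (λ z → 1ℚ + z) (absent xs x∉xs)) (ℚₚ.+-identityʳ 1ℚ))
  where
  absent : ∀ ys → All (x ≢_) ys → ∑ ys (λ y → 𝟙 (P? y)) ≡ 0ℚ
  absent []       []           = refl
  absent (y ∷ ys) (x≢y ∷ x∉ys) with P? y
  ... | yes Py = contradiction (P-unique Px Py) x≢y
  ... | no _   = trans (ℚₚ.+-identityˡ _) (absent ys x∉ys)

∑-average : ∀ (xs : List A) (f : A → ℚ) {m} → 0ℚ <ℚ ∑ xs (λ _ → 1ℚ) →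
  ∑ xs f ≤ℚ ∑ xs (λ _ → 1ℚ) * m → ∃[ x ] (x ∈ˡ xs × f x ≤ℚ m)
∑-average []       f 0<0 _ = contradiction refl (ℚₚ.<⇒≢ 0<0)
∑-average (x ∷ xs) f {m} _ ∑f≤ with f x ℚₚ.≤? m
... | yes fx≤m = x , here refl , fx≤m
... | no  fx≰m with xs in eq
...   | []     = contradiction (begin
  f x                ≡⟨ solve 1 (λ a → a := a :+ con 0ℚ) refl (f x) ⟩
  f x + 0ℚ           ≤⟨ ∑f≤ ⟩
  (1ℚ + 0ℚ) * m      ≡⟨ solve 1 (λ a → (con 1ℚ :+ con 0ℚ) :* a := a) refl m ⟩
  m                  ∎) fx≰m
  where open ℚₚ.≤-Reasoning
...   | y ∷ ys =
  let z , z∈ , fz≤m = ∑-average (y ∷ ys) f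
        (ℚₚ.<-≤-trans (ℚₚ.positive⁻¹ 1ℚ) (p≤p+q (∑-nonneg ys (λ _ → 0≤1)))) tail≤
  in z , there z∈ , fz≤m
  where
  open ℚₚ.≤-Reasoning
  tail≤ : ∑ (y ∷ ys) f ≤ℚ ∑ (y ∷ ys) (λ _ → 1ℚ) * m
  tail≤ = +-cancelʳ-≤ m (begin
    ∑ (y ∷ ys) f + m                          ≤⟨ ℚₚ.+-monoʳ-≤ (∑ (y ∷ ys) f) (ℚₚ.<⇒≤ (ℚₚ.≰⇒> fx≰m)) ⟩
    ∑ (y ∷ ys) f + f x                        ≡⟨ ℚₚ.+-comm _ (f x) ⟩
    f x + ∑ (y ∷ ys) f                        ≤⟨ ∑f≤ ⟩
    (1ℚ + ∑ (y ∷ ys) (λ _ → 1ℚ)) * m          ≡⟨ solve 2 (λ a b →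
      (con 1ℚ :+ a) :* b := a :* b :+ b) refl (∑ (y ∷ ys) (λ _ → 1ℚ)) m ⟩
    ∑ (y ∷ ys) (λ _ → 1ℚ) * m + m             ∎)

-- The potential

-- The indicator of the empty set, and below it that of the set containing just the first index.
-- Rational values let them be multiplied and summed.
none : Subset n → ℚ
none Vec.[]              = 1ℚ
none (outside Vec.∷ p) = none p
none (inside  Vec.∷ p) = 0ℚ

onlyHead : Subset (suc n) → ℚ
onlyHead (outside Vec.∷ p) = 0ℚ
onlyHead (inside  Vec.∷ p) = none p

factor : ℚ → Bool → ℚ
factor c true  = c
factor c false = 1ℚ

-- If S and T have the same last element k, their weight is v k times the product
-- of c i over the i < k in S ∪ T; it is 0 otherwise.
weight : (c v : Fin n → ℚ) → Subset n → Subset n → ℚ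
weight c v Vec.[]      Vec.[]      = 0ℚ
weight c v (a Vec.∷ S) (b Vec.∷ T) =
  v zero * (onlyHead (a Vec.∷ S) * onlyHead (b Vec.∷ T)) +
  factor (c zero) (a ∨ b) * weight (c ∘ suc) (v ∘ suc) S T

0≤none : (S : Subset n) → 0ℚ ≤ℚ none S
0≤none Vec.[]              = 0≤1
0≤none (outside Vec.∷ S) = 0≤none S
0≤none (inside  Vec.∷ S) = ℚₚ.≤-refl

0≤onlyHead : (S : Subset (suc n)) → 0ℚ ≤ℚ onlyHead S
0≤onlyHead (outside Vec.∷ S) = ℚₚ.≤-refl
0≤onlyHead (inside  Vec.∷ S) = 0≤none S

0≤factor : ∀ {c} → 0ℚ ≤ℚ c → ∀ b → 0ℚ ≤ℚ factor c b
0≤factor 0≤c true  = 0≤c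
0≤factor 0≤c false = 0≤1

0≤weight : ∀ {c v : Fin n → ℚ} → (∀ i → 0ℚ ≤ℚ c i) → (∀ i → 0ℚ ≤ℚ v i) →
  ∀ S T → 0ℚ ≤ℚ weight c v S T
0≤weight 0≤c 0≤v Vec.[]      Vec.[]      = ℚₚ.≤-refl
0≤weight 0≤c 0≤v (a Vec.∷ S) (b Vec.∷ T) =
  0≤+ (0≤* (0≤v zero) (0≤* (0≤onlyHead (a Vec.∷ S)) (0≤onlyHead (b Vec.∷ T))))
      (0≤* (0≤factor (0≤c zero) (a ∨ b)) (0≤weight (0≤c ∘ suc) (0≤v ∘ suc) S T))

-- A product kernel `f x * f y` sums to a square. This isolates the pairs that end at the first
-- coordinate, both among all subsets and in the energy of a collection.
∑∑-split : ∀ (xs : List A) v (f : A → ℚ) (g : A → A → ℚ) →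
  ∑ xs (λ x → ∑ xs (λ y → v * (f x * f y) + g x y)) ≡
  v * (∑ xs f * ∑ xs f) + ∑ xs (λ x → ∑ xs (g x))
∑∑-split xs v f g = begin
  ∑ xs (λ x → ∑ xs (λ y → v * (f x * f y) + g x y))
    ≡⟨ ∑-cong xs (λ x → ∑-+ xs (λ y → v * (f x * f y)) (g x)) ⟩
  ∑ xs (λ x → ∑ xs (λ y → v * (f x * f y)) + ∑ xs (g x))
    ≡⟨ ∑-+ xs (λ x → ∑ xs (λ y → v * (f x * f y))) (λ x → ∑ xs (g x)) ⟩
  ∑ xs (λ x → ∑ xs (λ y → v * (f x * f y))) + ∑ xs (λ x → ∑ xs (g x))
    ≡⟨ cong (_+ ∑ xs (λ x → ∑ xs (g x))) (begin
      ∑ xs (λ x → ∑ xs (λ y → v * (f x * f y)))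
        ≡⟨ ∑-cong xs (λ x → trans (∑-*ˡ xs v (λ y → f x * f y)) (cong (v *_) (∑-*ˡ xs (f x) f))) ⟩
      ∑ xs (λ x → v * (f x * ∑ xs f))
        ≡⟨ trans (∑-*ˡ xs v (λ x → f x * ∑ xs f)) (cong (v *_) (∑-*ʳ xs (∑ xs f) f)) ⟩
      v * (∑ xs f * ∑ xs f) ∎) ⟩
  v * (∑ xs f * ∑ xs f) + ∑ xs (λ x → ∑ xs (g x)) ∎
  where open ≡-Reasoning

subsets : ∀ n → List (Subset n)
subsets zero    = Vec.[] ∷ []
subsets (suc n) = map (outside Vec.∷_) (subsets n) ++ map (inside Vec.∷_) (subsets n)

∈-subsets : (S : Subset n) → S ∈ˡ subsets n
∈-subsets Vec.[]              = here refl
∈-subsets (outside Vec.∷ S) = ∈-++⁺ˡ (∈-map⁺ (outside Vec.∷_) (∈-subsets S))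
∈-subsets (inside  Vec.∷ S) = ∈-++⁺ʳ _ (∈-map⁺ (inside Vec.∷_) (∈-subsets S))

∑-subsets-suc : ∀ n (f : Subset (suc n) → ℚ) → ∑ (subsets (suc n)) f ≡
  ∑ (subsets n) (f ∘ (outside Vec.∷_)) + ∑ (subsets n) (f ∘ (inside Vec.∷_))
∑-subsets-suc n f = trans (∑-++ (map (outside Vec.∷_) (subsets n)) _ f)
  (cong₂ _+_ (∑-map (outside Vec.∷_) (subsets n) f) (∑-map (inside Vec.∷_) (subsets n) f))

∑-none : ∀ n → ∑ (subsets n) none ≡ 1ℚ
∑-none zero    = refl
∑-none (suc n) = trans (∑-subsets-suc n none)
  (trans (cong₂ _+_ (∑-none n) (∑-zero (subsets n))) (ℚₚ.+-identityʳ 1ℚ))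

∑-onlyHead : ∀ n → ∑ (subsets (suc n)) onlyHead ≡ 1ℚ
∑-onlyHead n = trans (∑-subsets-suc n onlyHead)
  (trans (cong₂ _+_ (∑-zero (subsets n)) (∑-none n)) (ℚₚ.+-identityˡ 1ℚ))

-- The Horner form of ∑_k v k ∏_{i < k} (1 + 3 c i).
totalWeight : (c v : Fin n → ℚ) → ℚ
totalWeight {zero}  c v = 0ℚ
totalWeight {suc n} c v =
  v zero + (1ℚ + (c zero + (c zero + c zero))) * totalWeight (c ∘ suc) (v ∘ suc)

-- An index below the common last element lies in neither set, contributing 1, or in the first, the
-- second or both, contributing `c` each time. Only one pair of sets ends at the first index.
∑∑-weight : (c v : Fin n → ℚ) →
  ∑ (subsets n) (λ S → ∑ (subsets n) (weight c v S)) ≡ totalWeight c v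
∑∑-weight {zero}  c v = refl
∑∑-weight {suc n} c v = begin
  ∑ (subsets (suc n)) (λ S → ∑ (subsets (suc n)) (weight c v S))
    ≡⟨ ∑-cong (subsets (suc n)) (λ S → ∑-cong (subsets (suc n)) (weight-∷ S)) ⟩
  ∑ (subsets (suc n)) (λ S → ∑ (subsets (suc n)) (λ T → v zero * (onlyHead S * onlyHead T) + rest S T))
    ≡⟨ ∑∑-split (subsets (suc n)) (v zero) onlyHead rest ⟩
  v zero * (∑ (subsets (suc n)) onlyHead * ∑ (subsets (suc n)) onlyHead) +
  ∑ (subsets (suc n)) (λ S → ∑ (subsets (suc n)) (rest S))
    ≡⟨ cong₂ (λ o r → v zero * (o * o) + r) (∑-onlyHead n) ∑∑-rest ⟩
  v zero * (1ℚ * 1ℚ) + (1ℚ + (c zero + (c zero + c zero))) * W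
    ≡⟨ cong (_+ (1ℚ + (c zero + (c zero + c zero))) * W) (ℚₚ.*-identityʳ (v zero)) ⟩
  v zero + (1ℚ + (c zero + (c zero + c zero))) * W
    ∎
  where
  open ≡-Reasoning
  W = totalWeight (c ∘ suc) (v ∘ suc)
  w = weight (c ∘ suc) (v ∘ suc)
  rest : Subset (suc n) → Subset (suc n) → ℚ
  rest (a Vec.∷ S) (b Vec.∷ T) = factor (c zero) (a ∨ b) * w S T
  weight-∷ : ∀ S T → weight c v S T ≡ v zero * (onlyHead S * onlyHead T) + rest S T
  weight-∷ (a Vec.∷ S) (b Vec.∷ T) = refl
  block : ∀ a b → ∑ (subsets n) (λ S → ∑ (subsets n) (λ T → factor (c zero) (a ∨ b) * w S T)) ≡
    factor (c zero) (a ∨ b) * W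
  block a b = trans (∑-cong (subsets n) (λ S → ∑-*ˡ (subsets n) (factor (c zero) (a ∨ b)) (w S)))
    (trans (∑-*ˡ (subsets n) (factor (c zero) (a ∨ b)) (λ S → ∑ (subsets n) (w S)))
           (cong (factor (c zero) (a ∨ b) *_) (∑∑-weight (c ∘ suc) (v ∘ suc))))
  row : ∀ a → ∑ (subsets n) (λ S → ∑ (subsets (suc n)) (rest (a Vec.∷ S))) ≡
    factor (c zero) (a ∨ outside) * W + factor (c zero) (a ∨ inside) * W
  row a = trans (∑-cong (subsets n) (λ S → ∑-subsets-suc n (rest (a Vec.∷ S))))
    (trans (∑-+ (subsets n) (λ S → ∑ (subsets n) (rest (a Vec.∷ S) ∘ (outside Vec.∷_)))
                            (λ S → ∑ (subsets n) (rest (a Vec.∷ S) ∘ (inside Vec.∷_))))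
           (cong₂ _+_ (block a outside) (block a inside)))
  ∑∑-rest : ∑ (subsets (suc n)) (λ S → ∑ (subsets (suc n)) (rest S)) ≡
    (1ℚ + (c zero + (c zero + c zero))) * W
  ∑∑-rest = trans (∑-subsets-suc n (λ S → ∑ (subsets (suc n)) (rest S)))
    (trans (cong₂ _+_ (row outside) (row inside))
      (solve 2 (λ c W → (con 1ℚ :* W :+ c :* W) :+ (c :* W :+ c :* W) :=
                        (con 1ℚ :+ (c :+ (c :+ c))) :* W) refl (c zero) W))

-- Planes

-- `nothing` marks a free coordinate and `just a` one fixed at `a`. Composing with `suc` then
-- forgets the first coordinate once its value has been chosen.
Plane : (Fin n → ℕ) → Set
Plane s = ∀ k → Maybe (Fin (s k))

support : ∀ {s : Fin n → ℕ} → Plane s → Subset n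
support P = Vec.tabulate (is-just ∘ P)

Agrees : ∀ {m} → Maybe (Fin m) → Fin m → Set
Agrees a y = Maybe.All (_≡ y) a

agrees? : ∀ {m} (a : Maybe (Fin m)) → Decidable (Agrees a)
agrees? a y = Maybe.dec (Finₚ._≟ y) a

_∋_ : ∀ {s : Fin n → ℕ} → Plane s → Point s → Set
P ∋ x = ∀ k → Agrees (P k) (x k)

energy : ∀ {s : Fin n → ℕ} → (c v : Fin n → ℚ) → List (Plane s) → ℚ
energy c v L = ∑ L (λ P → ∑ L (λ Q → weight c v (support P) (support Q)))

none-support : ∀ {s : Fin n → ℕ} (P : Plane s) →
  ((∀ k → P k ≡ nothing) × none (support P) ≡ 1ℚ) ⊎ ((∃[ k ] Is-just (P k)) × none (support P) ≡ 0ℚ)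
none-support {zero}  P = inj₁ ((λ ()) , refl)
none-support {suc n} P with P zero in eq
... | just _  = inj₂ ((zero , subst Is-just (sym eq) (MaybeAny.just _)) , refl)
... | nothing with none-support (P ∘ suc)
...   | inj₁ (P≡ , none≡)       = inj₁ ((λ { zero → eq ; (suc k) → P≡ k }) , none≡)
...   | inj₂ ((k , Pk) , none≡) = inj₂ ((suc k , Pk) , none≡)

-- The greedy choice of one coordinate

∑-agrees-≤1 : ∀ {m} (a : Fin m) → ∑ (allFin m) (λ y → 𝟙 (agrees? (just a) y)) ≤ℚ 1ℚ
∑-agrees-≤1 {m} a = ∑-𝟙-unique (agrees? (just a))
  (λ { (Maybe.just a≡x) (Maybe.just a≡y) → trans (sym a≡x) a≡y }) (allFin⁺ m)

square-cancel-≤ : 0ℚ ≤ℚ q → p * p ≤ℚ q * q → p ≤ℚ q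
square-cancel-≤ {q} {p} 0≤q p²≤q² with p ℚₚ.≤? q
... | yes p≤q = p≤q
... | no  p≰q = contradiction (ℚₚ.≤-<-trans p²≤q² q²<p²) (ℚₚ.<-irrefl refl)
  where
  q<p = ℚₚ.≰⇒> p≰q
  q²<p² : q * q <ℚ p * p
  q²<p² = ℚₚ.≤-<-trans (*-monoʳ-≤ q 0≤q (ℚₚ.<⇒≤ q<p))
    (ℚₚ.*-monoˡ-<-pos p {{positive (ℚₚ.≤-<-trans 0≤q q<p)}} q<p)

onlyHead≤none : ∀ b (S : Subset n) → onlyHead (b Vec.∷ S) ≤ℚ none S
onlyHead≤none outside S = 0≤none S
onlyHead≤none inside  S = ℚₚ.≤-refl

-- A plane fixing coordinate 0 alone forbids a single value of it; any other plane counts 0 on both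
-- sides.
∑-hits : ∀ {m} (a : Maybe (Fin m)) (S : Subset n) →
  ∑ (allFin m) (λ y → onlyHead (is-just a Vec.∷ S) * 𝟙 (agrees? a y)) ≤ℚ onlyHead (is-just a Vec.∷ S)
∑-hits {m = m} nothing S = ℚₚ.≤-reflexive (trans
  (∑-*ˡ (allFin m) 0ℚ (λ y → 𝟙 (agrees? nothing y))) (ℚₚ.*-zeroˡ (∑ (allFin m) (λ y → 𝟙 (agrees? nothing y)))))
∑-hits {m = m} (just a) S = begin
  ∑ (allFin m) (λ y → none S * 𝟙 (agrees? (just a) y)) ≡⟨ ∑-*ˡ (allFin m) (none S) _ ⟩
  none S * ∑ (allFin m) (λ y → 𝟙 (agrees? (just a) y)) ≤⟨ *-monoʳ-≤ (none S) (0≤none S) (∑-agrees-≤1 a) ⟩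
  none S * 1ℚ                                          ≡⟨ ℚₚ.*-identityʳ _ ⟩
  none S                                               ∎
  where open ℚₚ.≤-Reasoning

-- `toℕ` counts from 0, so the one-based index of `k` exceeds `C`. The threshold falls by one with
-- each chosen coordinate; at 0 it asks only that the plane still fixes something.
Reaches : ∀ {s : Fin n → ℕ} → ℕ → Plane s → Set
Reaches C P = ∃[ k ] (Is-just (P k) × C ≤ toℕ k)

restrict : ∀ {s : Fin (suc n) → ℕ} → List (Plane s) → Fin (s zero) → List (Plane (s ∘ suc))
restrict L y = map (_∘ suc) (filter (λ P → agrees? (P zero) y) L)

∈-restrict⁺ : ∀ {s : Fin (suc n) → ℕ} {L : List (Plane s)} {P} y →
  P ∈ˡ L → Agrees (P zero) y → P ∘ suc ∈ˡ restrict L y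
∈-restrict⁺ y P∈L Py = ∈-map⁺ (_∘ suc) (∈-filter⁺ (λ P → agrees? (P zero) y) P∈L Py)

∈-restrict⁻ : ∀ {s : Fin (suc n) → ℕ} (L : List (Plane s)) {P} y →
  P ∈ˡ restrict L y → ∃[ Q ] (Q ∈ˡ L × Agrees (Q zero) y × P ≡ Q ∘ suc)
∈-restrict⁻ L y P∈ with ∈-map⁻ (_∘ suc) P∈
... | Q , Q∈ , P≡ =
  let Q∈L , Qy = ∈-filter⁻ (λ P → agrees? (P zero) y) {xs = L} Q∈ in Q , Q∈L , Qy , P≡

-- One greedy step.  The diagonal terms of the energy bound the number of planes that
-- fix only coordinate 0, so the values y that avoid them make up a proportion at least t
-- of all values.  A pair of planes that fixes coordinate 0 survives for at most one of
-- these y, that is with frequency at most 1 / (t s₀) ≤ c 0, which makes up for the factor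
-- c 0 that is missing from the weight of its tails.
module Step {C : ℕ} {s : Fin (suc n) → ℕ} {c v : Fin (suc n) → ℚ} {t : ℚ}
  (0≤1-t : 0ℚ ≤ℚ 1ℚ - t)
  (0≤c : ∀ i → 0ℚ ≤ℚ c i) (0≤v : ∀ i → 0ℚ ≤ℚ v i)
  (c-large : 1ℚ ≤ℚ ι (s zero) * (t * c zero))
  (v-large : C ≤ 0 → 1ℚ ≤ℚ v zero * (ι (s zero) * ι (s zero)))
  (L : List (Plane s)) (reaches : ∀ {P} → P ∈ˡ L → Reaches C P)
  (energy-small : energy c v L ≤ℚ (1ℚ - t) * (1ℚ - t))
  where

  open ℚₚ.≤-Reasoning

  private
    c₀ = c zero
    m  = s zero

    tailWeight : Plane s → Plane s → ℚ
    tailWeight P Q = weight (c ∘ suc) (v ∘ suc) (support (P ∘ suc)) (support (Q ∘ suc))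

    0≤tailWeight : ∀ P Q → 0ℚ ≤ℚ tailWeight P Q
    0≤tailWeight P Q = 0≤weight (0≤c ∘ suc) (0≤v ∘ suc) (support (P ∘ suc)) (support (Q ∘ suc))

    headFactor : Plane s → Plane s → ℚ
    headFactor P Q = factor c₀ (is-just (P zero) ∨ is-just (Q zero))

    -- `τ` counts the planes that fix coordinate 0 alone. The energy is `v zero * (τ * τ)` plus the
    -- contribution `Ψ` of the pairs that end later.
    τ Ψ : ℚ
    τ = ∑ L (λ P → onlyHead (support P))
    Ψ = ∑ L (λ P → ∑ L (λ Q → headFactor P Q * tailWeight P Q))

    0≤τ : 0ℚ ≤ℚ τ
    0≤τ = ∑-nonneg L (λ P → 0≤onlyHead (support P))

    0≤Ψ : 0ℚ ≤ℚ Ψ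
    0≤Ψ = ∑-nonneg L (λ P → ∑-nonneg L (λ Q →
      0≤* (0≤factor (0≤c zero) (is-just (P zero) ∨ is-just (Q zero))) (0≤tailWeight P Q)))

    energy≡ : energy c v L ≡ v zero * (τ * τ) + Ψ
    energy≡ = ∑∑-split L (v zero) (λ P → onlyHead (support P)) (λ P Q → headFactor P Q * tailWeight P Q)

    diagonal≤ : v zero * (τ * τ) ≤ℚ (1ℚ - t) * (1ℚ - t)
    diagonal≤ = begin
      v zero * (τ * τ)       ≤⟨ p≤p+q 0≤Ψ ⟩
      v zero * (τ * τ) + Ψ   ≡⟨ energy≡ ⟨
      energy c v L           ≤⟨ energy-small ⟩
      (1ℚ - t) * (1ℚ - t)    ∎

    Ψ≤ : Ψ ≤ℚ (1ℚ - t) * (1ℚ - t)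
    Ψ≤ = begin
      Ψ                      ≤⟨ p≤q+p (0≤* (0≤v zero) (0≤* 0≤τ 0≤τ)) ⟩
      v zero * (τ * τ) + Ψ   ≡⟨ energy≡ ⟨
      energy c v L           ≤⟨ energy-small ⟩
      (1ℚ - t) * (1ℚ - t)    ∎

    -- The number of planes that fix coordinate 0 alone, at the value `y`. Being a natural number,
    -- it is less than 1 exactly when `y` is not forbidden.
    hits : Fin m → ℚ
    hits y = ∑ L (λ P → onlyHead (support P) * 𝟙 (agrees? (P zero) y))

    0≤hit : ∀ y (P : Plane s) → 0ℚ ≤ℚ onlyHead (support P) * 𝟙 (agrees? (P zero) y)
    0≤hit y P = 0≤* (0≤onlyHead (support P)) (𝟙-nonneg (agrees? (P zero) y))

    good? : Decidable (λ y → hits y <ℚ 1ℚ)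
    good? y = hits y ℚₚ.<? 1ℚ

    G : List (Fin m)
    G = filter good? (allFin m)

    g : ℚ
    g = ∑ G (λ _ → 1ℚ)

    ∑G≤ : ∀ (f : Fin m → ℚ) → (∀ y → 0ℚ ≤ℚ f y) → ∑ G f ≤ℚ ∑ (allFin m) f
    ∑G≤ f 0≤f = begin
      ∑ G f                                    ≡⟨ ∑-filter good? (allFin m) f ⟩
      ∑ (allFin m) (λ y → 𝟙 (good? y) * f y)   ≤⟨ ∑-mono (allFin m) (λ y → *-monoˡ-≤ (f y) (0≤f y) (𝟙≤1 (good? y))) ⟩
      ∑ (allFin m) (λ y → 1ℚ * f y)            ≡⟨ ∑-cong (allFin m) (λ y → ℚₚ.*-identityˡ (f y)) ⟩
      ∑ (allFin m) f                           ∎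

    good-or-hit : ∀ y → 1ℚ ≤ℚ 𝟙 (good? y) * 1ℚ + hits y
    good-or-hit y with good? y
    ... | yes _   = p≤p+q (∑-nonneg L (0≤hit y))
    ... | no  y≮  = begin
      1ℚ                 ≤⟨ ℚₚ.≮⇒≥ y≮ ⟩
      hits y             ≡⟨ ℚₚ.+-identityˡ (hits y) ⟨
      0ℚ * 1ℚ + hits y   ∎

    -- Every value is good or hit, and each of the `τ` planes hits at most one value.
    ιm≤g+τ : ι m ≤ℚ g + τ
    ιm≤g+τ = begin
      ι m
        ≡⟨ trans (∑-1 (allFin m)) (cong ι (length-tabulate {n = m} id)) ⟨
      ∑ (allFin m) (λ _ → 1ℚ)
        ≤⟨ ∑-mono (allFin m) good-or-hit ⟩
      ∑ (allFin m) (λ y → 𝟙 (good? y) * 1ℚ + hits y)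
        ≡⟨ ∑-+ (allFin m) (λ y → 𝟙 (good? y) * 1ℚ) hits ⟩
      ∑ (allFin m) (λ y → 𝟙 (good? y) * 1ℚ) + ∑ (allFin m) hits
        ≡⟨ cong₂ _+_ (sym (∑-filter good? (allFin m) (λ _ → 1ℚ)))
             (∑-comm (allFin m) L (λ y P → onlyHead (support P) * 𝟙 (agrees? (P zero) y))) ⟩
      g + ∑ L (λ P → ∑ (allFin m) (λ y → onlyHead (support P) * 𝟙 (agrees? (P zero) y)))
        ≤⟨ ℚₚ.+-monoʳ-≤ g (∑-mono L (λ P → ∑-hits (P zero) (support (P ∘ suc)))) ⟩
      g + τ ∎

    onlyHead≡0 : ∀ {P : Plane s} {k} → Is-just (P (suc k)) → onlyHead (support P) ≤ℚ 0ℚ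
    onlyHead≡0 {P} {k} Pk with none-support (P ∘ suc)
    ... | inj₁ (P≡ , _) with () ← subst Is-just (P≡ k) Pk
    ... | inj₂ (_ , none≡0) =
      subst (onlyHead (support P) ≤ℚ_) none≡0 (onlyHead≤none (is-just (P zero)) (support (P ∘ suc)))

    -- Once `C` is 0, `v zero` is at least `1 / m²`, and the bound on the diagonal terms becomes one
    -- on `τ`. While `C` is positive, every plane fixes a later coordinate and `τ` vanishes.
    τ≤ : τ ≤ℚ (1ℚ - t) * ι m
    τ≤ with C ℕ.≤? 0
    ... | yes C≤0 = square-cancel-≤ (0≤* 0≤1-t (0≤ι m)) (begin
      τ * τ                             ≡⟨ ℚₚ.*-identityʳ (τ * τ) ⟨
      (τ * τ) * 1ℚ                      ≤⟨ *-monoʳ-≤ (τ * τ) (0≤* 0≤τ 0≤τ) (v-large C≤0) ⟩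
      (τ * τ) * (v zero * (ι m * ι m))  ≡⟨ solve 3 (λ τ v m →
        (τ :* τ) :* (v :* (m :* m)) := (v :* (τ :* τ)) :* (m :* m)) refl τ (v zero) (ι m) ⟩
      (v zero * (τ * τ)) * (ι m * ι m)  ≤⟨ *-monoˡ-≤ (ι m * ι m) (0≤* (0≤ι m) (0≤ι m)) diagonal≤ ⟩
      ((1ℚ - t) * (1ℚ - t)) * (ι m * ι m) ≡⟨ solve 2 (λ δ m →
        (δ :* δ) :* (m :* m) := (δ :* m) :* (δ :* m)) refl (1ℚ - t) (ι m) ⟩
      ((1ℚ - t) * ι m) * ((1ℚ - t) * ι m) ∎)
    ... | no  C≰0 = begin
      τ                  ≤⟨ ∑-mono-∈ L onlyHead≤0 ⟩
      ∑ L (λ _ → 0ℚ)     ≡⟨ ∑-zero L ⟩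
      0ℚ                 ≤⟨ 0≤* 0≤1-t (0≤ι m) ⟩
      (1ℚ - t) * ι m     ∎
      where
      onlyHead≤0 : ∀ {P} → P ∈ˡ L → onlyHead (support P) ≤ℚ 0ℚ
      onlyHead≤0 {P} P∈L with reaches P∈L
      ... | zero  , _  , C≤0 = contradiction C≤0 C≰0
      ... | suc k , Pk , _   = onlyHead≡0 {P} Pk

    tm≤g : t * ι m ≤ℚ g
    tm≤g = +-cancelʳ-≤ ((1ℚ - t) * ι m) (begin
      t * ι m + (1ℚ - t) * ι m ≡⟨ solve 2 (λ t m → t :* m :+ (con 1ℚ :- t) :* m := m) refl t (ι m) ⟩
      ι m                      ≤⟨ ιm≤g+τ ⟩
      g + τ                    ≤⟨ ℚₚ.+-monoʳ-≤ g τ≤ ⟩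
      g + (1ℚ - t) * ι m       ∎)

    1≤gc : 1ℚ ≤ℚ g * c₀
    1≤gc = begin
      1ℚ               ≤⟨ c-large ⟩
      ι m * (t * c₀)   ≡⟨ solve 3 (λ m t c → m :* (t :* c) := (t :* m) :* c) refl (ι m) t c₀ ⟩
      (t * ι m) * c₀   ≤⟨ *-monoˡ-≤ c₀ (0≤c zero) tm≤g ⟩
      g * c₀           ∎

    0<g : 0ℚ <ℚ g
    0<g with 0ℚ ℚₚ.<? g
    ... | yes 0<g = 0<g
    ... | no  0≮g = contradiction (begin
      1ℚ        ≤⟨ 1≤gc ⟩
      g * c₀    ≤⟨ *-monoˡ-≤ c₀ (0≤c zero) (ℚₚ.≮⇒≥ 0≮g) ⟩
      0ℚ * c₀   ≡⟨ ℚₚ.*-zeroˡ c₀ ⟩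
      0ℚ        ∎) (<⇒≱ (ℚₚ.positive⁻¹ 1ℚ))

    pairs : Maybe (Fin m) → Maybe (Fin m) → Fin m → ℚ
    pairs a b y = 𝟙 (agrees? a y) * 𝟙 (agrees? b y)

    ∑G-agrees : ∀ a → ∑ G (λ y → 𝟙 (agrees? (just a) y)) ≤ℚ g * c₀
    ∑G-agrees a = ℚₚ.≤-trans (∑G≤ _ (λ y → 𝟙-nonneg (agrees? (just a) y)))
      (ℚₚ.≤-trans (∑-agrees-≤1 a) 1≤gc)

    -- One fixed value already limits the pair to a single `y`, so if the first plane has one, the
    -- agreement of the second is bounded by 1.
    ∑G-pairs : ∀ a b → ∑ G (pairs a b) ≤ℚ g * factor c₀ (is-just a ∨ is-just b)
    ∑G-pairs nothing nothing = ℚₚ.≤-reflexive (sym (ℚₚ.*-identityʳ g))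
    ∑G-pairs nothing (just b) = ℚₚ.≤-trans
      (∑-mono G (λ y → ℚₚ.≤-reflexive (ℚₚ.*-identityˡ (𝟙 (agrees? (just b) y))))) (∑G-agrees b)
    ∑G-pairs (just a) b = ℚₚ.≤-trans
      (∑-mono G (λ y → ℚₚ.≤-trans
        (*-monoʳ-≤ (𝟙 (agrees? (just a) y)) (𝟙-nonneg (agrees? (just a) y)) (𝟙≤1 (agrees? b y)))
        (ℚₚ.≤-reflexive (ℚₚ.*-identityʳ (𝟙 (agrees? (just a) y))))))
      (∑G-agrees a)

    tailEnergy : Fin m → ℚ
    tailEnergy y = energy (c ∘ suc) (v ∘ suc) (restrict L y)

    ∑-restrict : ∀ y f → ∑ (restrict L y) f ≡ ∑ L (λ P → 𝟙 (agrees? (P zero) y) * f (P ∘ suc))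
    ∑-restrict y f = trans (∑-map (_∘ suc) (filter (λ P → agrees? (P zero) y) L) f)
      (∑-filter (λ P → agrees? (P zero) y) L (λ P → f (P ∘ suc)))

    tailEnergy≡ : ∀ y → tailEnergy y ≡ ∑ L (λ P → ∑ L (λ Q → pairs (P zero) (Q zero) y * tailWeight P Q))
    tailEnergy≡ y = trans (∑-restrict y _) (∑-cong L (λ P →
      trans (cong (𝟙 (agrees? (P zero) y) *_) (∑-restrict y _))
        (trans (sym (∑-*ˡ L (𝟙 (agrees? (P zero) y)) (λ Q → 𝟙 (agrees? (Q zero) y) * tailWeight P Q)))
          (∑-cong L (λ Q → sym (ℚₚ.*-assoc (𝟙 (agrees? (P zero) y)) _ (tailWeight P Q)))))))

    ∑-tailEnergy : ∑ G tailEnergy ≤ℚ g * Ψ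
    ∑-tailEnergy = begin
      ∑ G tailEnergy
        ≡⟨ ∑-cong G tailEnergy≡ ⟩
      ∑ G (λ y → ∑ L (λ P → ∑ L (λ Q → pairs (P zero) (Q zero) y * tailWeight P Q)))
        ≡⟨ ∑-comm G L (λ y P → ∑ L (λ Q → pairs (P zero) (Q zero) y * tailWeight P Q)) ⟩
      ∑ L (λ P → ∑ G (λ y → ∑ L (λ Q → pairs (P zero) (Q zero) y * tailWeight P Q)))
        ≡⟨ ∑-cong L (λ P → trans
             (∑-comm G L (λ y Q → pairs (P zero) (Q zero) y * tailWeight P Q))
             (∑-cong L (λ Q → ∑-*ʳ G (tailWeight P Q) (pairs (P zero) (Q zero))))) ⟩
      ∑ L (λ P → ∑ L (λ Q → ∑ G (pairs (P zero) (Q zero)) * tailWeight P Q))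
        ≤⟨ ∑-mono L (λ P → ∑-mono L (λ Q →
             *-monoˡ-≤ (tailWeight P Q) (0≤tailWeight P Q) (∑G-pairs (P zero) (Q zero)))) ⟩
      ∑ L (λ P → ∑ L (λ Q → (g * headFactor P Q) * tailWeight P Q))
        ≡⟨ ∑-cong L (λ P → trans
             (∑-cong L (λ Q → ℚₚ.*-assoc g (headFactor P Q) (tailWeight P Q)))
             (∑-*ˡ L g (λ Q → headFactor P Q * tailWeight P Q))) ⟩
      ∑ L (λ P → g * ∑ L (λ Q → headFactor P Q * tailWeight P Q))
        ≡⟨ ∑-*ˡ L g (λ P → ∑ L (λ Q → headFactor P Q * tailWeight P Q)) ⟩
      g * Ψ ∎

    abstract
      best : ∃[ y ] (y ∈ˡ G × tailEnergy y ≤ℚ Ψ)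
      best = ∑-average G tailEnergy 0<g ∑-tailEnergy

  choice : Fin m
  choice = proj₁ best

  tail-energy-small : energy (c ∘ suc) (v ∘ suc) (restrict L choice) ≤ℚ (1ℚ - t) * (1ℚ - t)
  tail-energy-small = ℚₚ.≤-trans (proj₂ (proj₂ best)) Ψ≤

  private
    hits<1 : hits choice <ℚ 1ℚ
    hits<1 = proj₂ (∈-filter⁻ good? {xs = allFin m} (proj₁ (proj₂ best)))

    hit≡1 : ∀ {m} (a : Maybe (Fin m)) (S : Subset n) y → Is-just a → Agrees a y → none S ≡ 1ℚ →
      onlyHead (is-just a Vec.∷ S) * 𝟙 (agrees? a y) ≡ 1ℚ
    hit≡1 (just a) S y _ ay none≡1 with agrees? (just a) y
    ... | yes _  = trans (ℚₚ.*-identityʳ (none S)) none≡1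
    ... | no ¬ay = contradiction ay ¬ay

    -- A witness beyond coordinate 0 shifts down. If the witness is coordinate 0, then `C` is 0 and
    -- any fixed coordinate of the tail will do; with none, `P` would be a hit at `choice`, which is
    -- a good value.
    tail-reaches : ∀ {P} → P ∈ˡ L → Agrees (P zero) choice → Reaches (C ℕ.∸ 1) (P ∘ suc)
    tail-reaches {P} P∈L Py with reaches P∈L | none-support (P ∘ suc)
    ... | suc k , Pk , C≤k | _                   = k , Pk , ℕₚ.∸-monoˡ-≤ 1 C≤k
    ... | zero  , _  , C≤0 | inj₂ ((k , Pk) , _) = k , Pk , ℕₚ.≤-trans (ℕₚ.∸-monoˡ-≤ 1 C≤0) z≤n
    ... | zero  , P₀ , _   | inj₁ (_ , none≡1)   = contradiction (begin
      1ℚ                                                      ≡⟨ hit≡1 (P zero) (support (P ∘ suc)) choice P₀ Py none≡1 ⟨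
      onlyHead (support P) * 𝟙 (agrees? (P zero) choice)      ≤⟨ ∑-∈-≤ (0≤hit choice) P∈L ⟩
      hits choice                                             ∎) (<⇒≱ hits<1)

  restrict-reaches : ∀ {P} → P ∈ˡ restrict L choice → Reaches (C ℕ.∸ 1) P
  restrict-reaches P∈ with ∈-restrict⁻ L choice P∈
  ... | P , P∈L , Py , refl = tail-reaches P∈L Py

-- Induction on the number of coordinates: `Step` hands both invariants, reaching past the threshold
-- and small energy, to the planes that survive the choice.
avoid : ∀ {C} {s : Fin n → ℕ} {c v : Fin n → ℚ} {t} →
  0ℚ ≤ℚ 1ℚ - t → (∀ i → 0ℚ ≤ℚ c i) → (∀ i → 0ℚ ≤ℚ v i) →
  (∀ i → 1ℚ ≤ℚ ι (s i) * (t * c i)) →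
  (∀ i → C ≤ toℕ i → 1ℚ ≤ℚ v i * (ι (s i) * ι (s i))) →
  ∀ (L : List (Plane s)) → (∀ {P} → P ∈ˡ L → Reaches C P) →
  energy c v L ≤ℚ (1ℚ - t) * (1ℚ - t) →
  ∃[ x ] (∀ {P} → P ∈ˡ L → ¬ (P ∋ x))
-- Without coordinates no plane reaches anything, so `L` is empty.
avoid {zero} _ _ _ _ _ L reaches _ = (λ ()) , λ P∈L _ → Finₚ.¬Fin0 (proj₁ (reaches P∈L))
avoid {suc n} {C} {s} {c} {v} {t} 0≤1-t 0≤c 0≤v c-large v-large L reaches energy-small = x , x-avoids
  where
  open Step {C = C} {s} {c} {v} {t} 0≤1-t 0≤c 0≤v (c-large zero) (v-large zero) L reaches energy-small
  tail : ∃[ x ] (∀ {P} → P ∈ˡ restrict L choice → ¬ (P ∋ x))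
  tail = avoid {t = t} 0≤1-t (0≤c ∘ suc) (0≤v ∘ suc) (c-large ∘ suc)
    (λ i C≤i → v-large (suc i) (ℕₚ.≤-trans (ℕₚ.m≤n+m∸n C 1) (s≤s C≤i)))
    (restrict L choice) restrict-reaches tail-energy-small
  x : Point s
  x zero    = choice
  x (suc k) = proj₁ tail k
  x-avoids : ∀ {P} → P ∈ˡ L → ¬ (P ∋ x)
  x-avoids P∈L P∋x = proj₂ tail (∈-restrict⁺ choice P∈L (P∋x zero)) (P∋x ∘ suc)

-- The total weight

ι-mono-≤ : ∀ {m n} → m ≤ n → ι m ≤ℚ ι n
ι-mono-≤ {n = n} z≤n = 0≤ι n
ι-mono-≤ (s≤s m≤n)   = ℚₚ.+-monoʳ-≤ 1ℚ (ι-mono-≤ m≤n)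

ι-pos : ∀ n → 0ℚ <ℚ ι (suc n)
ι-pos n = ℚₚ.<-≤-trans (ℚₚ.positive⁻¹ 1ℚ) (p≤p+q (0≤ι n))

*-cancelˡ-≤ : ∀ r → 0ℚ <ℚ r → r * p ≤ℚ r * q → p ≤ℚ q
*-cancelˡ-≤ r 0<r = ℚₚ.*-cancelˡ-≤-pos r {{positive 0<r}}

triple : ℚ → ℚ
triple c = c + (c + c)

-- The number `J` with `2 d / (δ J) = δ² / 4 ^ N` when `δ = 1 / d`.
doublings : ℕ → ℕ → ℕ
doublings N d = 2 ℕ.* ((d ℕ.* (d ℕ.* (d ℕ.* d))) ℕ.* 4 ℕ.^ N)

cutoff : ℕ → ℕ → ℕ
cutoff N d = 2 ℕ.^ doublings N d ℕ.* suc N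

-- The recursion makes u k = k (b k) bounded by d beyond N.  Below the cutoff it
-- also makes u grow by a factor 1 + δ / (k + 1) per step, hence by the
-- additive amount (δ / 2) u (N + 1) each time k doubles, so u (N + 1) is small.
-- The number of doublings turns δ J u (N + 1) ≤ 2 d and b 1 ≤ 4 ^ N u (N + 1)
-- into b 1 ≤ δ².
module SmallTotal {N d n : ℕ} {δ : ℚ} {c v b : ℕ → ℚ}
  (0≤δ : 0ℚ ≤ℚ δ) (0≤1-δ : 0ℚ ≤ℚ 1ℚ - δ) (δd≡1 : δ * ι d ≡ 1ℚ)
  (0≤b : ∀ k → 0ℚ ≤ℚ b k)
  (b-rec : ∀ k → b k ≤ℚ v k + (1ℚ + triple (c k)) * b (suc k))
  (b-end : ∀ k → suc n ≤ k → b k ≡ 0ℚ)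
  (c≤1 : ∀ k → 1 ≤ k → c k ≤ℚ 1ℚ)
  (c-small : ∀ k → suc N ≤ k → ι k * triple (c k) ≤ℚ 1ℚ - δ)
  (v-small : ∀ k → suc N ≤ k → ι k * ι (suc k) * v k ≤ℚ 1ℚ)
  (v-zero : ∀ k → k ≤ cutoff N d → v k ≡ 0ℚ)
  where

  open ℚₚ.≤-Reasoning

  private
    D = ι d
    M = suc N

    u : ℕ → ℚ
    u k = ι k * b k

    0≤u : ∀ k → 0ℚ ≤ℚ u k
    0≤u k = 0≤* (0≤ι k) (0≤b k)

    u-rec : ∀ k → suc N ≤ k → u k ≤ℚ ι k * v k + (ι k + (1ℚ - δ)) * b (suc k)
    u-rec k N<k = begin
      ι k * b k
        ≤⟨ *-monoʳ-≤ (ι k) (0≤ι k) (b-rec k) ⟩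
      ι k * (v k + (1ℚ + triple (c k)) * b (suc k))
        ≡⟨ solve 4 (λ k v c b → k :* (v :+ (con 1ℚ :+ c) :* b) := k :* v :+ (k :+ k :* c) :* b) refl
             (ι k) (v k) (triple (c k)) (b (suc k)) ⟩
      ι k * v k + (ι k + ι k * triple (c k)) * b (suc k)
        ≤⟨ ℚₚ.+-monoʳ-≤ (ι k * v k)
             (*-monoˡ-≤ (b (suc k)) (0≤b (suc k)) (ℚₚ.+-monoʳ-≤ (ι k) (c-small k N<k))) ⟩
      ι k * v k + (ι k + (1ℚ - δ)) * b (suc k) ∎

    -- Induction downwards from beyond `n`, where `b` vanishes; `l` bounds the distance left. The
    -- bound `D` reproduces itself: after multiplication by `k + 1`, the `v` term costs at most
    -- `1 = δ * D`, which is what the factor `k + 1 - δ` leaves free.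
    u≤D : ∀ l k → suc N ≤ k → suc n ≤ l ℕ.+ k → u k ≤ℚ D
    u≤D zero k _ n<k = begin
      ι k * b k    ≡⟨ cong (ι k *_) (b-end k n<k) ⟩
      ι k * 0ℚ     ≡⟨ ℚₚ.*-zeroʳ (ι k) ⟩
      0ℚ           ≤⟨ 0≤ι d ⟩
      D            ∎
    u≤D (suc l) k N<k n<l+k = *-cancelˡ-≤ (ι (suc k)) (ι-pos k) (begin
      ι (suc k) * u k
        ≤⟨ *-monoʳ-≤ (ι (suc k)) (0≤ι (suc k)) (u-rec k N<k) ⟩
      ι (suc k) * (ι k * v k + (ι k + (1ℚ - δ)) * b (suc k))
        ≡⟨ solve 5 (λ k k′ v e b → k′ :* (k :* v :+ (k :+ e) :* b) := k :* k′ :* v :+ (k :+ e) :* (k′ :* b)) refl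
             (ι k) (ι (suc k)) (v k) (1ℚ - δ) (b (suc k)) ⟩
      ι k * ι (suc k) * v k + (ι k + (1ℚ - δ)) * u (suc k)
        ≤⟨ ℚₚ.+-mono-≤ (v-small k N<k) (*-monoʳ-≤ (ι k + (1ℚ - δ)) (0≤+ (0≤ι k) 0≤1-δ)
             (u≤D l (suc k) (ℕₚ.m≤n⇒m≤1+n N<k) (subst (suc n ≤_) (sym (ℕₚ.+-suc l k)) n<l+k))) ⟩
      1ℚ + (ι k + (1ℚ - δ)) * D
        ≡⟨ cong (_+ (ι k + (1ℚ - δ)) * D) (sym δd≡1) ⟩
      δ * D + (ι k + (1ℚ - δ)) * D
        ≡⟨ solve 3 (λ k δ D → δ :* D :+ (k :+ (con 1ℚ :- δ)) :* D := (con 1ℚ :+ k) :* D) refl (ι k) δ D ⟩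
      ι (suc k) * D ∎)

    u-rec′ : ∀ k → suc N ≤ k → k ≤ cutoff N d → u k ≤ℚ (ι k + (1ℚ - δ)) * b (suc k)
    u-rec′ k N<k k≤C = begin
      u k
        ≤⟨ u-rec k N<k ⟩
      ι k * v k + (ι k + (1ℚ - δ)) * b (suc k)
        ≡⟨ cong (λ v → ι k * v + (ι k + (1ℚ - δ)) * b (suc k)) (v-zero k k≤C) ⟩
      ι k * 0ℚ + (ι k + (1ℚ - δ)) * b (suc k)
        ≡⟨ solve 2 (λ k x → k :* con 0ℚ :+ x := x) refl (ι k) ((ι k + (1ℚ - δ)) * b (suc k)) ⟩
      (ι k + (1ℚ - δ)) * b (suc k) ∎

    u-step : ∀ k → suc N ≤ k → k ≤ cutoff N d → u k ≤ℚ u (suc k)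
    u-step k N<k k≤C = begin
      u k                              ≤⟨ u-rec′ k N<k k≤C ⟩
      (ι k + (1ℚ - δ)) * b (suc k)     ≤⟨ p≤p+q (0≤* 0≤δ (0≤b (suc k))) ⟩
      (ι k + (1ℚ - δ)) * b (suc k) + δ * b (suc k)
        ≡⟨ solve 3 (λ k δ b → (k :+ (con 1ℚ :- δ)) :* b :+ δ :* b := (con 1ℚ :+ k) :* b) refl (ι k) δ (b (suc k)) ⟩
      ι (suc k) * b (suc k)            ∎

    -- The growth factor `1 + δ / (k + 1)`, cleared of its denominator. The recursion leaves a gain
    -- of `δ * u (suc k)`, and `u-step` lowers it to `δ * u k`.
    u-growth : ∀ k → suc N ≤ k → k ≤ cutoff N d → ι (suc k) * u k + δ * u k ≤ℚ ι (suc k) * u (suc k)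
    u-growth k N<k k≤C = begin
      ι (suc k) * u k + δ * u k
        ≤⟨ ℚₚ.+-mono-≤ (*-monoʳ-≤ (ι (suc k)) (0≤ι (suc k)) (u-rec′ k N<k k≤C))
                       (*-monoʳ-≤ δ 0≤δ (u-step k N<k k≤C)) ⟩
      ι (suc k) * ((ι k + (1ℚ - δ)) * b (suc k)) + δ * u (suc k)
        ≡⟨ solve 3 (λ k δ b → (con 1ℚ :+ k) :* ((k :+ (con 1ℚ :- δ)) :* b) :+ δ :* ((con 1ℚ :+ k) :* b)
                      := (con 1ℚ :+ k) :* ((con 1ℚ :+ k) :* b)) refl (ι k) δ (b (suc k)) ⟩
      ι (suc k) * u (suc k) ∎

    -- This gives all steps of a block a common denominator `R`. The excess of `R` over `k + 1`
    -- multiplies only the inequality `u k ≤ u (suc k)`.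
    u-growth-wide : ∀ {R} k → ι (suc k) ≤ℚ R → suc N ≤ k → k ≤ cutoff N d →
      R * u k + δ * u k ≤ℚ R * u (suc k)
    u-growth-wide {R} k k<R N<k k≤C = begin
      R * u k + δ * u k
        ≡⟨ solve 4 (λ R x δ k′ → R :* x :+ δ :* x := (R :- k′) :* x :+ (k′ :* x :+ δ :* x)) refl R (u k) δ (ι (suc k)) ⟩
      (R - ι (suc k)) * u k + (ι (suc k) * u k + δ * u k)
        ≤⟨ ℚₚ.+-mono-≤ (*-monoʳ-≤ (R - ι (suc k)) 0≤R-k′ (u-step k N<k k≤C)) (u-growth k N<k k≤C) ⟩
      (R - ι (suc k)) * u (suc k) + ι (suc k) * u (suc k)
        ≡⟨ solve 3 (λ R x k′ → (R :- k′) :* x :+ k′ :* x := R :* x) refl R (u (suc k)) (ι (suc k)) ⟩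
      R * u (suc k) ∎
      where
      0≤R-k′ : 0ℚ ≤ℚ R - ι (suc k)
      0≤R-k′ = ℚₚ.≤-trans (ℚₚ.≤-reflexive (sym (ℚₚ.+-inverseʳ (ι (suc k))))) (ℚₚ.+-monoˡ-≤ (- ι (suc k)) k<R)

    u-mono : ∀ i k → suc N ≤ k → i ℕ.+ k ≤ suc (cutoff N d) → u k ≤ℚ u (i ℕ.+ k)
    u-mono zero    k N<k i+k≤C = ℚₚ.≤-refl
    u-mono (suc i) k N<k i+k≤C = ℚₚ.≤-trans
      (u-mono i k N<k (ℕₚ.≤-trans (ℕₚ.n≤1+n _) i+k≤C))
      (u-step (i ℕ.+ k) (ℕₚ.≤-trans N<k (ℕₚ.m≤n+m k i)) (ℕₚ.≤-pred i+k≤C))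

    -- Each of the `i` steps from `k` ends at an index of at most `2 k`, so it gains at least
    -- `δ * u k / (2 k)`.
    block : ∀ i k → suc N ≤ k → i ≤ k → i ℕ.+ k ≤ suc (cutoff N d) →
      ι (k ℕ.+ k) * u k + ι i * (δ * u k) ≤ℚ ι (k ℕ.+ k) * u (i ℕ.+ k)
    block zero    k _   _   _     = ℚₚ.≤-reflexive
      (solve 2 (λ x y → x :+ con 0ℚ :* y := x) refl (ι (k ℕ.+ k) * u k) (δ * u k))
    block (suc i) k N<k i<k i+k≤C = begin
      R * u k + ι (suc i) * (δ * u k)
        ≡⟨ solve 3 (λ x i y → x :+ (con 1ℚ :+ i) :* y := (x :+ i :* y) :+ y) refl (R * u k) (ι i) (δ * u k) ⟩
      (R * u k + ι i * (δ * u k)) + δ * u k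
        ≤⟨ ℚₚ.+-mono-≤ (block i k N<k (ℕₚ.≤-trans (ℕₚ.n≤1+n i) i<k) i+k≤C′)
             (*-monoʳ-≤ δ 0≤δ (u-mono i k N<k i+k≤C′)) ⟩
      R * u (i ℕ.+ k) + δ * u (i ℕ.+ k)
        ≤⟨ u-growth-wide (i ℕ.+ k) (ι-mono-≤ (ℕₚ.+-monoˡ-≤ k i<k))
             (ℕₚ.≤-trans N<k (ℕₚ.m≤n+m k i)) (ℕₚ.≤-pred i+k≤C) ⟩
      R * u (suc i ℕ.+ k) ∎
      where
      R = ι (k ℕ.+ k)
      i+k≤C′ = ℕₚ.≤-trans (ℕₚ.n≤1+n (i ℕ.+ k)) i+k≤C

    -- The block with `i = k`, divided by `k`. The gain is half of `δ * u k`; both sides are doubled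
    -- to avoid the fraction.
    doubling : ∀ k → suc N ≤ k → k ℕ.+ k ≤ cutoff N d → u k + u k + δ * u k ≤ℚ u (k ℕ.+ k) + u (k ℕ.+ k)
    doubling k@(suc k-1) N<k 2k≤C = *-cancelˡ-≤ (ι k) (ι-pos k-1) (begin
      ι k * (u k + u k + δ * u k)
        ≡⟨ solve 3 (λ k x y → k :* (x :+ x :+ y) := (k :+ k) :* x :+ k :* y) refl (ι k) (u k) (δ * u k) ⟩
      (ι k + ι k) * u k + ι k * (δ * u k)
        ≡⟨ cong (λ R → R * u k + ι k * (δ * u k)) (×-homo-+ 1ℚ k k) ⟨
      ι (k ℕ.+ k) * u k + ι k * (δ * u k)
        ≤⟨ block k k N<k ℕₚ.≤-refl (ℕₚ.m≤n⇒m≤1+n 2k≤C) ⟩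
      ι (k ℕ.+ k) * u (k ℕ.+ k)
        ≡⟨ cong (_* u (k ℕ.+ k)) (×-homo-+ 1ℚ k k) ⟩
      (ι k + ι k) * u (k ℕ.+ k)
        ≡⟨ solve 2 (λ k x → (k :+ k) :* x := k :* (x :+ x)) refl (ι k) (u (k ℕ.+ k)) ⟩
      ι k * (u (k ℕ.+ k) + u (k ℕ.+ k)) ∎)

    N<2^jM : ∀ j → suc N ≤ 2 ℕ.^ j ℕ.* M
    N<2^jM j = ℕₚ.m≤n*m M (2 ℕ.^ j) {{ℕₚ.m^n≢0 2 j}}

    -- Each doubling gains in proportion to the current value of `u`, which is at least `u M`; so
    -- the gain is linear in `j`.
    repeated-doubling : ∀ j → j ≤ doublings N d →
      u M + u M + ι j * (δ * u M) ≤ℚ u (2 ℕ.^ j ℕ.* M) + u (2 ℕ.^ j ℕ.* M)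
    repeated-doubling zero    _   = ℚₚ.≤-reflexive (trans
      (solve 2 (λ x y → x :+ con 0ℚ :* y := x) refl (u M + u M) (δ * u M))
      (sym (cong (λ k → u k + u k) (ℕₚ.+-identityʳ M))))
    repeated-doubling (suc j) j<J = begin
      u M + u M + ι (suc j) * (δ * u M)
        ≡⟨ solve 3 (λ x i y → x :+ (con 1ℚ :+ i) :* y := (x :+ i :* y) :+ y) refl (u M + u M) (ι j) (δ * u M) ⟩
      (u M + u M + ι j * (δ * u M)) + δ * u M
        ≤⟨ ℚₚ.+-mono-≤ (repeated-doubling j (ℕₚ.<⇒≤ j<J)) (*-monoʳ-≤ δ 0≤δ uM≤uk) ⟩
      u k + u k + δ * u k
        ≤⟨ doubling k (N<2^jM j) 2k≤C ⟩
      u (k ℕ.+ k) + u (k ℕ.+ k)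
        ≡⟨ cong (λ k → u k + u k) k+k≡ ⟩
      u (2 ℕ.^ suc j ℕ.* M) + u (2 ℕ.^ suc j ℕ.* M) ∎
      where
      k = 2 ℕ.^ j ℕ.* M
      k+k≡ : k ℕ.+ k ≡ 2 ℕ.^ suc j ℕ.* M
      k+k≡ = trans (cong (k ℕ.+_) (sym (ℕₚ.+-identityʳ k))) (sym (ℕₚ.*-assoc 2 (2 ℕ.^ j) M))
      2k≤C : k ℕ.+ k ≤ cutoff N d
      2k≤C = ℕₚ.≤-trans (ℕₚ.≤-reflexive k+k≡) (ℕₚ.*-monoˡ-≤ M (ℕₚ.^-monoʳ-≤ 2 j<J))
      uM≤uk : u M ≤ℚ u k
      uM≤uk = subst (λ k → u M ≤ℚ u k) (ℕₚ.m∸n+n≡m (N<2^jM j))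
        (u-mono (k ℕ.∸ M) M ℕₚ.≤-refl (ℕₚ.≤-trans (ℕₚ.≤-reflexive (ℕₚ.m∸n+n≡m (N<2^jM j)))
          (ℕₚ.m≤n⇒m≤1+n (ℕₚ.≤-trans (ℕₚ.m≤m+n k k) 2k≤C))))

    E = ι (4 ℕ.^ N)

    -- Up to `N` only `c ≤ 1` is known, so each step costs a factor `1 + 3 c ≤ 4`; the `v` terms
    -- vanish below the cutoff.
    b₁≤ : ∀ i → i ≤ N → b 1 ≤ℚ ι (4 ℕ.^ i) * b (suc i)
    b₁≤ zero    _   = ℚₚ.≤-reflexive (sym (ℚₚ.*-identityˡ (b 1)))
    b₁≤ (suc i) i<N = begin
      b 1
        ≤⟨ b₁≤ i (ℕₚ.<⇒≤ i<N) ⟩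
      ι (4 ℕ.^ i) * b (suc i)
        ≤⟨ *-monoʳ-≤ (ι (4 ℕ.^ i)) (0≤ι (4 ℕ.^ i)) (b-rec (suc i)) ⟩
      ι (4 ℕ.^ i) * (v (suc i) + (1ℚ + triple (c (suc i))) * b (suc (suc i)))
        ≤⟨ *-monoʳ-≤ (ι (4 ℕ.^ i)) (0≤ι (4 ℕ.^ i)) (ℚₚ.+-mono-≤
             (ℚₚ.≤-reflexive (v-zero (suc i) i<C))
             (*-monoˡ-≤ (b (suc (suc i))) (0≤b (suc (suc i))) (ℚₚ.+-monoʳ-≤ 1ℚ triple≤))) ⟩
      ι (4 ℕ.^ i) * (0ℚ + ι 4 * b (suc (suc i)))
        ≡⟨ solve 3 (λ x y z → x :* (con 0ℚ :+ y :* z) := (y :* x) :* z) refl (ι (4 ℕ.^ i)) (ι 4) (b (suc (suc i))) ⟩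
      (ι 4 * ι (4 ℕ.^ i)) * b (suc (suc i))
        ≡⟨ cong (_* b (suc (suc i))) (×1-homo-* 4 (4 ℕ.^ i)) ⟨
      ι (4 ℕ.^ suc i) * b (suc (suc i)) ∎
      where
      i<C : suc i ≤ cutoff N d
      i<C = ℕₚ.≤-trans i<N (ℕₚ.≤-trans (ℕₚ.n≤1+n N) (N<2^jM (doublings N d)))
      triple≤ : triple (c (suc i)) ≤ℚ ι 3
      triple≤ = let c≤1′ = c≤1 (suc i) (s≤s z≤n) in ℚₚ.+-mono-≤ c≤1′ (ℚₚ.+-mono-≤ c≤1′ c≤1′)

    ι-doublings : ι (doublings N d) ≡ (1ℚ + 1ℚ) * ((D * (D * (D * D))) * E)
    ι-doublings = begin-equality
      ι (doublings N d)
        ≡⟨ ×1-homo-* 2 ((d ℕ.* (d ℕ.* (d ℕ.* d))) ℕ.* 4 ℕ.^ N) ⟩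
      ι 2 * ι ((d ℕ.* (d ℕ.* (d ℕ.* d))) ℕ.* 4 ℕ.^ N)
        ≡⟨ cong (ι 2 *_) (×1-homo-* (d ℕ.* (d ℕ.* (d ℕ.* d))) (4 ℕ.^ N)) ⟩
      ι 2 * (ι (d ℕ.* (d ℕ.* (d ℕ.* d))) * E)
        ≡⟨ cong (λ x → ι 2 * (x * E)) (trans (×1-homo-* d (d ℕ.* (d ℕ.* d)))
             (cong (D *_) (trans (×1-homo-* d (d ℕ.* d)) (cong (D *_) (×1-homo-* d d))))) ⟩
      (1ℚ + 1ℚ) * ((D * (D * (D * D))) * E) ∎

    -- The linear gain against the bound `D` at the cutoff gives `δ J (u M) ≤ 2 D`. Multiplying by
    -- `δ` makes the right side 2, and the choice of `J` makes the left side twice the claimed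
    -- quantity.
    D²EuM≤1 : (D * D) * (E * u M) ≤ℚ 1ℚ
    D²EuM≤1 = *-cancelˡ-≤ (1ℚ + 1ℚ) (ℚₚ.positive⁻¹ (1ℚ + 1ℚ)) (begin
      (1ℚ + 1ℚ) * ((D * D) * (E * u M))
        ≡⟨ cong (λ x → (1ℚ + 1ℚ) * (x * (E * u M))) D²≡ ⟩
      (1ℚ + 1ℚ) * (((δ * δ) * ((D * D) * (D * D))) * (E * u M))
        ≡⟨ solve 4 (λ δ D E x → (con 1ℚ :+ con 1ℚ) :* (((δ :* δ) :* ((D :* D) :* (D :* D))) :* (E :* x))
                       := δ :* (((con 1ℚ :+ con 1ℚ) :* ((D :* (D :* (D :* D))) :* E)) :* (δ :* x))) refl δ D E (u M) ⟩
      δ * (((1ℚ + 1ℚ) * ((D * (D * (D * D))) * E)) * (δ * u M))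
        ≡⟨ cong (λ x → δ * (x * (δ * u M))) ι-doublings ⟨
      δ * (ι (doublings N d) * (δ * u M))
        ≤⟨ *-monoʳ-≤ δ 0≤δ (p≤q+p (0≤+ (0≤u M) (0≤u M))) ⟩
      δ * (u M + u M + ι (doublings N d) * (δ * u M))
        ≤⟨ *-monoʳ-≤ δ 0≤δ (repeated-doubling (doublings N d) ℕₚ.≤-refl) ⟩
      δ * (u (cutoff N d) + u (cutoff N d))
        ≤⟨ *-monoʳ-≤ δ 0≤δ (ℚₚ.+-mono-≤ uC≤D uC≤D) ⟩
      δ * (D + D)
        ≡⟨ ℚₚ.*-distribˡ-+ δ D D ⟩
      δ * D + δ * D
        ≡⟨ cong₂ _+_ δd≡1 δd≡1 ⟩
      1ℚ + 1ℚ
        ≡⟨ ℚₚ.*-identityʳ (1ℚ + 1ℚ) ⟨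
      (1ℚ + 1ℚ) * 1ℚ ∎)
      where
      D²≡ : D * D ≡ (δ * δ) * ((D * D) * (D * D))
      D²≡ = begin-equality
        D * D                               ≡⟨ ℚₚ.*-identityˡ (D * D) ⟨
        1ℚ * (D * D)                        ≡⟨ cong (_* (D * D)) (cong₂ _*_ δd≡1 δd≡1) ⟨
        ((δ * D) * (δ * D)) * (D * D)       ≡⟨ solve 2 (λ δ D →
          ((δ :* D) :* (δ :* D)) :* (D :* D) := (δ :* δ) :* ((D :* D) :* (D :* D))) refl δ D ⟩
        (δ * δ) * ((D * D) * (D * D))       ∎
      uC≤D : u (cutoff N d) ≤ℚ D
      uC≤D = u≤D (suc n) (cutoff N d) (N<2^jM (doublings N d)) (ℕₚ.m≤m+n (suc n) (cutoff N d))

  b₁≤δ² : b 1 ≤ℚ δ * δ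
  b₁≤δ² = begin
    b 1
      ≤⟨ b₁≤ N ℕₚ.≤-refl ⟩
    E * b M
      ≤⟨ *-monoʳ-≤ E (0≤ι (4 ℕ.^ N)) (ℚₚ.≤-trans (ℚₚ.≤-reflexive (sym (ℚₚ.*-identityˡ (b M))))
           (*-monoˡ-≤ (b M) (0≤b M) (p≤p+q {p = 1ℚ} (0≤ι N)))) ⟩
    E * u M
      ≡⟨ ℚₚ.*-identityˡ (E * u M) ⟨
    (1ℚ * 1ℚ) * (E * u M)
      ≡⟨ cong (_* (E * u M)) (cong₂ _*_ δd≡1 δd≡1) ⟨
    ((δ * D) * (δ * D)) * (E * u M)
      ≡⟨ solve 3 (λ δ D x → ((δ :* D) :* (δ :* D)) :* x := (δ :* δ) :* ((D :* D) :* x)) refl δ D (E * u M) ⟩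
    (δ * δ) * ((D * D) * (E * u M))
      ≤⟨ *-monoʳ-≤ (δ * δ) (0≤* 0≤δ 0≤δ) D²EuM≤1 ⟩
    (δ * δ) * 1ℚ
      ≡⟨ ℚₚ.*-identityʳ (δ * δ) ⟩
    δ * δ ∎

-- Reciprocals

-- The default value at 0 keeps `inv` nonnegative everywhere, even at the unconstrained `q 0`.
inv : ℕ → ℚ
inv zero    = 0ℚ
inv (suc n) = (1/ ι (suc n)) {{ℚₚ.pos⇒nonZero (ι (suc n)) {{positive (ι-pos n)}}}}

ι*inv : ∀ {n} → 1 ≤ n → ι n * inv n ≡ 1ℚ
ι*inv {suc n} _ = ℚₚ.*-inverseʳ (ι (suc n)) {{ℚₚ.pos⇒nonZero (ι (suc n)) {{positive (ι-pos n)}}}}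

0≤inv : ∀ n → 0ℚ ≤ℚ inv n
0≤inv zero    = ℚₚ.≤-refl
0≤inv (suc n) = ℚₚ.nonNegative⁻¹ (inv (suc n)) {{ℚₚ.pos⇒nonNeg (inv (suc n))
  {{ℚₚ.1/pos⇒pos (ι (suc n)) {{positive (ι-pos n)}}}}}}

ι*inv≤1 : ∀ {m n} → 1 ≤ n → m ≤ n → ι m * inv n ≤ℚ 1ℚ
ι*inv≤1 {m} {n} 1≤n m≤n = ℚₚ.≤-trans (*-monoˡ-≤ (inv n) (0≤inv n) (ι-mono-≤ m≤n))
  (ℚₚ.≤-reflexive (ι*inv 1≤n))

0<ι : ∀ {n} → 1 ≤ n → 0ℚ <ℚ ι n
0<ι {suc n} _ = ι-pos n

-- The total weight as a recursion on the starting index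

total : (c v : ℕ → ℚ) → ℕ → ℕ → ℚ
total c v k zero    = 0ℚ
total c v k (suc l) = v k + (1ℚ + triple (c k)) * total c v (suc k) l

totalWeight≡total : ∀ {c v : ℕ → ℚ} k {c′ v′ : Fin n → ℚ} →
  (∀ i → c′ i ≡ c (k ℕ.+ toℕ i)) → (∀ i → v′ i ≡ v (k ℕ.+ toℕ i)) → totalWeight c′ v′ ≡ total c v k n
totalWeight≡total {zero}          k c′≡ v′≡ = refl
totalWeight≡total {suc n} {c} {v} k {c′} {v′} c′≡ v′≡ = cong₂ _+_ (at-k v v′≡)
  (cong₂ (λ x y → (1ℚ + triple x) * y) (at-k c c′≡)
    (totalWeight≡total (suc k) (λ i → trans (c′≡ (suc i)) (cong c (ℕₚ.+-suc k (toℕ i))))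
                               (λ i → trans (v′≡ (suc i)) (cong v (ℕₚ.+-suc k (toℕ i))))))
  where
  at-k : ∀ (f : ℕ → ℚ) {f′ : Fin (suc n) → ℚ} → (∀ i → f′ i ≡ f (k ℕ.+ toℕ i)) → f′ zero ≡ f k
  at-k f f′≡ = trans (f′≡ zero) (cong f (ℕₚ.+-identityʳ k))

0≤triple : ∀ {c} → 0ℚ ≤ℚ c → 0ℚ ≤ℚ triple c
0≤triple 0≤c = 0≤+ 0≤c (0≤+ 0≤c 0≤c)

0≤total : ∀ {c v : ℕ → ℚ} → (∀ k → 0ℚ ≤ℚ c k) → (∀ k → 0ℚ ≤ℚ v k) → ∀ k l → 0ℚ ≤ℚ total c v k l
0≤total 0≤c 0≤v k zero    = ℚₚ.≤-refl
0≤total 0≤c 0≤v k (suc l) =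
  0≤+ (0≤v k) (0≤* (0≤+ 0≤1 (0≤triple (0≤c k))) (0≤total 0≤c 0≤v (suc k) l))

-- The weights of a sequence q that eventually satisfies q k ≥ (3 + 1 / b) k.
-- With d = 6 b + 2 and δ = 1 / d, such k satisfy 3 k ≤ (1 - δ)² (q k).
module Weights {q : ℕ → ℕ} (2≤q : ∀ k → 1 ≤ k → 2 ≤ q k) {N b : ℕ} (1≤b : 1 ≤ b)
  (q-large : ∀ k → suc N ≤ k → (3 ℕ.* b ℕ.+ 1) ℕ.* k ≤ q k ℕ.* b)
  where

  open ℚₚ.≤-Reasoning

  e d C : ℕ
  e = 6 ℕ.* b ℕ.+ 1
  d = suc e
  C = cutoff N d

  δ : ℚ
  δ = inv d

  c v : ℕ → ℚ
  -- Since `1 - δ = e / d`, this is `1 / (q k * (1 - δ))`.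
  c k = inv (q k) * (ι d * inv e)
  -- No plane under consideration ends at a coordinate up to C.
  v k with k ℕ.≤? C
  ... | yes _ = 0ℚ
  ... | no  _ = inv (q k) * inv (q k)

  private
    1≤q : ∀ k → 1 ≤ k → 1 ≤ q k
    1≤q k 1≤k = ℕₚ.≤-trans (s≤s z≤n) (2≤q k 1≤k)

    1≤e : 1 ≤ e
    1≤e = ℕₚ.m≤n+m 1 (6 ℕ.* b)

  0≤δ : 0ℚ ≤ℚ δ
  0≤δ = 0≤inv d

  0≤c : ∀ k → 0ℚ ≤ℚ c k
  0≤c k = 0≤* (0≤inv (q k)) (0≤* (0≤ι d) (0≤inv e))

  0≤v : ∀ k → 0ℚ ≤ℚ v k
  0≤v k with k ℕ.≤? C
  ... | yes _ = ℚₚ.≤-refl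
  ... | no  _ = 0≤* (0≤inv (q k)) (0≤inv (q k))

  private
    δd≡1 : δ * ι d ≡ 1ℚ
    δd≡1 = trans (ℚₚ.*-comm δ (ι d)) (ι*inv {d} (s≤s z≤n))

    1-δ≡ : 1ℚ - δ ≡ ι e * δ
    1-δ≡ = begin-equality
      1ℚ - δ                 ≡⟨ cong (_- δ) δd≡1 ⟨
      δ * ι d - δ            ≡⟨ solve 2 (λ δ e → δ :* (con 1ℚ :+ e) :- δ := e :* δ) refl δ (ι e) ⟩
      ι e * δ                ∎

    0≤1-δ : 0ℚ ≤ℚ 1ℚ - δ
    0≤1-δ = subst (0ℚ ≤ℚ_) (sym 1-δ≡) (0≤* (0≤ι e) 0≤δ)

  c-large : ∀ k → 1 ≤ k → 1ℚ ≤ℚ ι (q k) * ((1ℚ - δ) * c k)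
  c-large k 1≤k = ℚₚ.≤-reflexive (sym (begin-equality
    ι (q k) * ((1ℚ - δ) * c k)
      ≡⟨ cong (λ t → ι (q k) * (t * c k)) 1-δ≡ ⟩
    ι (q k) * ((ι e * δ) * (inv (q k) * (ι d * inv e)))
      ≡⟨ solve 6 (λ q q′ e e′ d d′ → q :* ((e :* d′) :* (q′ :* (d :* e′))) := (q :* q′) :* ((e :* e′) :* (d′ :* d)))
           refl (ι (q k)) (inv (q k)) (ι e) (inv e) (ι d) δ ⟩
    (ι (q k) * inv (q k)) * ((ι e * inv e) * (δ * ι d))
      ≡⟨ cong₂ _*_ (ι*inv (1≤q k 1≤k)) (cong₂ _*_ (ι*inv 1≤e) δd≡1) ⟩
    1ℚ * (1ℚ * 1ℚ)
      ≡⟨⟩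
    1ℚ ∎))

  v-large : ∀ k → C ≤ k → 1ℚ ≤ℚ v (suc k) * (ι (q (suc k)) * ι (q (suc k)))
  v-large k C≤k with suc k ℕ.≤? C
  ... | yes k<C = contradiction C≤k (ℕₚ.<⇒≱ k<C)
  ... | no  _   = ℚₚ.≤-reflexive (sym (trans
    (solve 2 (λ q q′ → (q′ :* q′) :* (q :* q) := (q :* q′) :* (q :* q′)) refl (ι (q (suc k))) (inv (q (suc k))))
    (cong₂ _*_ q*inv q*inv)))
    where q*inv = ι*inv (1≤q (suc k) (s≤s z≤n))

  private
    v-zero : ∀ k → k ≤ C → v k ≡ 0ℚ
    v-zero k k≤C with k ℕ.≤? C
    ... | yes _  = refl
    ... | no k≰C = contradiction k≤C k≰C

    -- `q k ≥ 2 k ≥ k + 1`, the latter because `k ≥ 1`.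
    k<q : ∀ k → suc N ≤ k → suc k ≤ q k
    k<q k N<k = ℕₚ.≤-trans (ℕₚ.+-monoˡ-≤ k (ℕₚ.≤-trans (s≤s z≤n) N<k))
      (ℕₚ.*-cancelʳ-≤ (k ℕ.+ k) (q k) b {{ℕ.>-nonZero 1≤b}} (ℕₚ.≤-trans 2kb≤ (q-large k N<k)))
      where
      2kb≤ : (k ℕ.+ k) ℕ.* b ≤ (3 ℕ.* b ℕ.+ 1) ℕ.* k
      2kb≤ = ℕₚ.≤-trans (ℕₚ.m≤m+n ((k ℕ.+ k) ℕ.* b) (b ℕ.* k ℕ.+ k)) (ℕₚ.≤-reflexive
        (solveℕ 2 (λ k b → (k ⊕ k) ⊛ b ⊕ (b ⊛ k ⊕ k) ≔ (conℕ 3 ⊛ b ⊕ conℕ 1) ⊛ k) refl k b))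

    v-small : ∀ k → suc N ≤ k → ι k * ι (suc k) * v k ≤ℚ 1ℚ
    v-small k N<k with k ℕ.≤? C
    ... | yes _ = ℚₚ.≤-trans (ℚₚ.≤-reflexive (ℚₚ.*-zeroʳ (ι k * ι (suc k)))) 0≤1
    ... | no  _ = begin
      ι k * ι (suc k) * (inv (q k) * inv (q k))
        ≡⟨ solve 3 (λ k k′ x → k :* k′ :* (x :* x) := (k :* x) :* (k′ :* x)) refl (ι k) (ι (suc k)) (inv (q k)) ⟩
      (ι k * inv (q k)) * (ι (suc k) * inv (q k))
        ≤⟨ *-mono-≤ (0≤* (0≤ι k) (0≤inv (q k))) 0≤1
             (ι*inv≤1 1≤qk (ℕₚ.<⇒≤ (k<q k N<k))) (ι*inv≤1 1≤qk (k<q k N<k)) ⟩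
      1ℚ ∎
      where 1≤qk = 1≤q k (ℕₚ.≤-trans (s≤s z≤n) N<k)

    -- `d / e ≤ 2 ≤ q k`, since `d = e + 1` and `e ≥ 1`.
    c≤1 : ∀ k → 1 ≤ k → c k ≤ℚ 1ℚ
    c≤1 k 1≤k = *-cancelˡ-≤ (ι e) (0<ι 1≤e) (begin
      ι e * (inv (q k) * (ι d * inv e))
        ≡⟨ solve 4 (λ e e′ q′ d → e :* (q′ :* (d :* e′)) := (e :* e′) :* (d :* q′)) refl (ι e) (inv e) (inv (q k)) (ι d) ⟩
      (ι e * inv e) * (ι d * inv (q k))
        ≡⟨ trans (cong (_* (ι d * inv (q k))) (ι*inv 1≤e)) (ℚₚ.*-identityˡ (ι d * inv (q k))) ⟩
      ι d * inv (q k)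
        ≤⟨ *-monoˡ-≤ (inv (q k)) (0≤inv (q k)) (ι-mono-≤ (ℕₚ.≤-trans (ℕₚ.+-monoˡ-≤ e 1≤e) (ℕₚ.≤-reflexive e+e≡))) ⟩
      ι (e ℕ.* 2) * inv (q k)
        ≡⟨ trans (cong (_* inv (q k)) (×1-homo-* e 2)) (ℚₚ.*-assoc (ι e) (ι 2) (inv (q k))) ⟩
      ι e * (ι 2 * inv (q k))
        ≤⟨ *-monoʳ-≤ (ι e) (0≤ι e) (ι*inv≤1 (1≤q k 1≤k) (2≤q k 1≤k)) ⟩
      ι e * 1ℚ ∎)
      where
      e+e≡ : e ℕ.+ e ≡ e ℕ.* 2
      e+e≡ = trans (cong (e ℕ.+_) (sym (ℕₚ.+-identityʳ e))) (ℕₚ.*-comm 2 e)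

    -- The choice of `d` gives `3 d² = 12 (3 b + 1)²` and `e² = 12 (3 b + 1) b + 1`. So `q-large`
    -- times `12 (3 b + 1)` proves this with `q k` to spare.
    3kd²≤qe² : ∀ k → suc N ≤ k → 3 ℕ.* k ℕ.* (d ℕ.* d) ≤ q k ℕ.* (e ℕ.* e)
    3kd²≤qe² k N<k = ℕR.begin
      3 ℕ.* k ℕ.* (d ℕ.* d)
        ℕR.≡⟨ solveℕ 2 (λ k b → conℕ 3 ⊛ k ⊛ ((conℕ 1 ⊕ (conℕ 6 ⊛ b ⊕ conℕ 1)) ⊛ (conℕ 1 ⊕ (conℕ 6 ⊛ b ⊕ conℕ 1)))
             ≔ (conℕ 12 ⊛ (conℕ 1 ⊕ conℕ 3 ⊛ b)) ⊛ ((conℕ 3 ⊛ b ⊕ conℕ 1) ⊛ k)) refl k b ⟩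
      (12 ℕ.* (1 ℕ.+ 3 ℕ.* b)) ℕ.* ((3 ℕ.* b ℕ.+ 1) ℕ.* k)
        ℕR.≤⟨ ℕₚ.*-monoʳ-≤ (12 ℕ.* (1 ℕ.+ 3 ℕ.* b)) (q-large k N<k) ⟩
      (12 ℕ.* (1 ℕ.+ 3 ℕ.* b)) ℕ.* (q k ℕ.* b)
        ℕR.≤⟨ ℕₚ.m≤m+n _ (q k) ⟩
      (12 ℕ.* (1 ℕ.+ 3 ℕ.* b)) ℕ.* (q k ℕ.* b) ℕ.+ q k
        ℕR.≡⟨ solveℕ 2 (λ q b → (conℕ 12 ⊛ (conℕ 1 ⊕ conℕ 3 ⊛ b)) ⊛ (q ⊛ b) ⊕ q
             ≔ q ⊛ ((conℕ 6 ⊛ b ⊕ conℕ 1) ⊛ (conℕ 6 ⊛ b ⊕ conℕ 1))) refl (q k) b ⟩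
      q k ℕ.* (e ℕ.* e) ℕR.∎
      where
      module ℕR = ℕₚ.≤-Reasoning

    -- With `c k = d / (q k * e)` and `1 - δ = e / d`, clearing denominators leaves `3kd²≤qe²`.
    c-small : ∀ k → suc N ≤ k → ι k * triple (c k) ≤ℚ 1ℚ - δ
    c-small k N<k = begin
      ι k * triple (inv (q k) * (ι d * inv e))
        ≡⟨ solve 4 (λ k q′ d e′ → k :* (q′ :* (d :* e′) :+ (q′ :* (d :* e′) :+ q′ :* (d :* e′)))
             := (((con 1ℚ :+ (con 1ℚ :+ (con 1ℚ :+ con 0ℚ))) :* k) :* d) :* (q′ :* e′)) refl (ι k) (inv (q k)) (ι d) (inv e) ⟩
      (ι 3 * ι k * ι d) * (inv (q k) * inv e)
        ≡⟨ ℚₚ.*-identityʳ _ ⟨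
      (ι 3 * ι k * ι d) * (inv (q k) * inv e) * 1ℚ
        ≡⟨ cong ((ι 3 * ι k * ι d) * (inv (q k) * inv e) *_) δd≡1 ⟨
      (ι 3 * ι k * ι d) * (inv (q k) * inv e) * (δ * ι d)
        ≡⟨ solve 4 (λ x d y δ → (x :* d) :* y :* (δ :* d) := (x :* (d :* d)) :* (y :* δ)) refl
             (ι 3 * ι k) (ι d) (inv (q k) * inv e) δ ⟩
      ((ι 3 * ι k) * (ι d * ι d)) * ((inv (q k) * inv e) * δ)
        ≡⟨ cong (_* ((inv (q k) * inv e) * δ)) (ι-*-* 3 k d d) ⟨
      ι (3 ℕ.* k ℕ.* (d ℕ.* d)) * ((inv (q k) * inv e) * δ)
        ≤⟨ *-monoˡ-≤ ((inv (q k) * inv e) * δ) (0≤* (0≤* (0≤inv (q k)) (0≤inv e)) 0≤δ) (ι-mono-≤ (3kd²≤qe² k N<k)) ⟩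
      ι (q k ℕ.* (e ℕ.* e)) * ((inv (q k) * inv e) * δ)
        ≡⟨ cong (_* ((inv (q k) * inv e) * δ)) (trans (×1-homo-* (q k) (e ℕ.* e)) (cong (ι (q k) *_) (×1-homo-* e e))) ⟩
      (ι (q k) * (ι e * ι e)) * ((inv (q k) * inv e) * δ)
        ≡⟨ solve 5 (λ q q′ e e′ δ → (q :* (e :* e)) :* ((q′ :* e′) :* δ) := (q :* q′) :* (e :* e′) :* (e :* δ)) refl
             (ι (q k)) (inv (q k)) (ι e) (inv e) δ ⟩
      (ι (q k) * inv (q k)) * (ι e * inv e) * (ι e * δ)
        ≡⟨ cong₂ (λ x y → x * y * (ι e * δ)) (ι*inv (1≤q k (ℕₚ.≤-trans (s≤s z≤n) N<k))) (ι*inv 1≤e) ⟩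
      1ℚ * 1ℚ * (ι e * δ)
        ≡⟨ ℚₚ.*-identityˡ (ι e * δ) ⟩
      ι e * δ
        ≡⟨ 1-δ≡ ⟨
      1ℚ - δ ∎
      where
      ι-*-* : ∀ w x y z → ι (w ℕ.* x ℕ.* (y ℕ.* z)) ≡ (ι w * ι x) * (ι y * ι z)
      ι-*-* w x y z = trans (×1-homo-* (w ℕ.* x) (y ℕ.* z)) (cong₂ _*_ (×1-homo-* w x) (×1-homo-* y z))

  total-small : ∀ n → total c v 1 n ≤ℚ δ * δ
  -- Here `b k` is the total over the coordinates from `k` to `n`; truncated subtraction makes it 0
  -- beyond `n`.
  total-small n = SmallTotal.b₁≤δ² {N = N} {d} {n} {δ} {c} {v} {λ k → total c v k (suc n ℕ.∸ k)}
    0≤δ 0≤1-δ δd≡1 (λ k → 0≤total 0≤c 0≤v k (suc n ℕ.∸ k)) rec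
    (λ k n<k → cong (total c v k) (ℕₚ.m≤n⇒m∸n≡0 n<k)) c≤1 c-small v-small v-zero
    where
    rec : ∀ k → total c v k (suc n ℕ.∸ k) ≤ℚ v k + (1ℚ + triple (c k)) * total c v (suc k) (n ℕ.∸ k)
    rec k with k ℕ.≤? n
    ... | yes k≤n = ℚₚ.≤-reflexive (cong (total c v k) (ℕₚ.+-∸-assoc 1 k≤n))
    ... | no  k≰n = ℚₚ.≤-trans (ℚₚ.≤-reflexive (cong (total c v k) (ℕₚ.m≤n⇒m∸n≡0 (ℕₚ.≰⇒> k≰n))))
      (0≤total 0≤c 0≤v k (suc (n ℕ.∸ k)))

_≟ˢ_ : (S T : Subset n) → Dec (S ≡ T)
_≟ˢ_ = ≡-dec _≟ᵇ_

-- Between integers, `3 < r` says that the numerator of `r` is at least three times its denominator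
-- plus 1. Cross-multiplying `r ≤ ratio q j` gives the rest.
ratio-bound : ∀ {q : ℕ → ℕ} {j} r → (+ 3 / 1) <ℚ r → r ≤ℚ ratio q j →
  (3 ℕ.* ↧ₙ r ℕ.+ 1) ℕ.* suc j ≤ q (suc j) ℕ.* ↧ₙ r
ratio-bound {q} {j} r@record{} 3<r r≤ = ℤₚ.drop‿+≤+ (begin
  + ((3 ℕ.* ↧ₙ r ℕ.+ 1) ℕ.* suc j)     ≡⟨ ℤₚ.pos-* (3 ℕ.* ↧ₙ r ℕ.+ 1) (suc j) ⟩
  + (3 ℕ.* ↧ₙ r ℕ.+ 1) ℤ.* + suc j     ≤⟨ ℤₚ.*-monoʳ-≤-nonNeg (+ suc j) numerator-large ⟩
  -- `ratio` is in lowest terms; the unnormalised rationals recover `q (suc j)` over `suc j`.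
  ↥ r ℤ.* + suc j                      ≤⟨ ℚᵘₚ.drop-*≤* (ℚᵘₚ.≤-respʳ-≃
    (ℚₚ.toℚᵘ-fromℚᵘ (mkℚᵘ (+ q (suc j)) j)) (ℚₚ.toℚᵘ-mono-≤ r≤)) ⟩
  + q (suc j) ℤ.* ↧ r                  ≡⟨ ℤₚ.pos-* (q (suc j)) (↧ₙ r) ⟨
  + (q (suc j) ℕ.* ↧ₙ r)               ∎)
  where
  open ℤₚ.≤-Reasoning
  numerator-large : + (3 ℕ.* ↧ₙ r ℕ.+ 1) ℤ.≤ ↥ r
  numerator-large = begin
    + (3 ℕ.* ↧ₙ r ℕ.+ 1)        ≡⟨ cong +_ (ℕₚ.+-comm (3 ℕ.* ↧ₙ r) 1) ⟩
    ℤ.suc (+ (3 ℕ.* ↧ₙ r))      ≡⟨ cong ℤ.suc (ℤₚ.pos-* 3 (↧ₙ r)) ⟩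
    ℤ.suc (+ 3 ℤ.* ↧ r)         ≤⟨ ℤₚ.i<j⇒suc[i]≤j (ℚₚ.drop-*<* 3<r) ⟩
    ↥ r ℤ.* + 1                 ≡⟨ ℤₚ.*-identityʳ (↥ r) ⟩
    ↥ r                         ∎

-- Hyperplanes as planes

module _ {n : ℕ} {s : Fin n → ℕ} where

  plane : Hyperplane s → Plane s
  plane A k with full⊎single A k
  ... | inj₁ _       = nothing
  ... | inj₂ (x , _) = just x

  ∈⇒∋ : ∀ {A x} → ⟦ A ⟧ x → plane A ∋ x
  ∈⇒∋ {A} {x} x∈A k with full⊎single A k
  ... | inj₁ _          = Maybe.nothing
  ... | inj₂ (y , side≡) = Maybe.just (sym (x∈⁅y⁆⇒x≡y y (subst (x k ∈ˢ_) side≡ (x∈A k))))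

  ∋⇒∈ : ∀ {A x} → plane A ∋ x → ⟦ A ⟧ x
  ∋⇒∈ {A} {x} P∋x k with full⊎single A k | P∋x k
  ... | inj₁ side≡       | _             = subst (x k ∈ˢ_) (sym side≡) ∈⊤
  ... | inj₂ (y , side≡) | Maybe.just y≡ = subst (x k ∈ˢ_) (sym side≡) (subst (_∈ˢ ⁅ y ⁆) y≡ (x∈⁅x⁆ y))

  fixed⇒F : ∀ A {k} → Is-just (plane A k) → F A k
  fixed⇒F A {k} just-k with full⊎single A k
  ... | inj₂ single = single

  -- A side recorded as full could be a singleton only if it had one element, which cardinality
  -- excludes.
  F⇒fixed : (∀ k → 2 ≤ s k) → ∀ A {k} → F A k → Is-just (plane A k)
  F⇒fixed 2≤s A {k} (x , side≡) with full⊎single A k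
  ... | inj₂ _    = MaybeAny.just _
  ... | inj₁ full = contradiction
    (trans (sym (∣⊤∣≡n (s k))) (trans (cong ∣_∣ (trans (sym full) side≡)) (∣⁅x⁆∣≡1 x)))
    (ℕₚ.>⇒≢ (2≤s k))

  support⇒is-just : ∀ (P Q : Plane s) → support P ≡ support Q → ∀ k → is-just (P k) ≡ is-just (Q k)
  support⇒is-just P Q P≡Q k = trans (sym (lookup∘tabulate (is-just ∘ P) k))
    (trans (cong (λ S → Vec.lookup S k) P≡Q) (lookup∘tabulate (is-just ∘ Q) k))

  support⇒fixed : ∀ (P Q : Plane s) → support P ≡ support Q → ∀ {k} → Is-just (P k) → Is-just (Q k)
  support⇒fixed P Q P≡Q {k} Pk with P k | Q k | support⇒is-just P Q P≡Q k
  ... | just _ | just _ | _ = MaybeAny.just _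

  same-support⇒parallel : (∀ k → 2 ≤ s k) → ∀ A B → support (plane A) ≡ support (plane B) → Parallel A B
  same-support⇒parallel 2≤s A B A≡B =
    (λ {k} → fixed⇒F B ∘ support⇒fixed (plane A) (plane B) A≡B {k} ∘ F⇒fixed 2≤s A) ,
    (λ {k} → fixed⇒F A ∘ support⇒fixed (plane B) (plane A) (sym A≡B) {k} ∘ F⇒fixed 2≤s B)

  pick : Point s → Plane s → Point s
  pick o P k = fromMaybe (o k) (P k)

  ∋-pick : ∀ o P → P ∋ pick o P
  ∋-pick o P k with P k
  ... | just _  = Maybe.just refl
  ... | nothing = Maybe.nothing

  _∋?_ : ∀ (P : Plane s) x → Dec (P ∋ x)
  P ∋? x = Finₚ.all? (λ k → agrees? (P k) (x k))

  -- Planes of equal support can differ only in their fixed values, and a single point of `P` shows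
  -- all of these. This reduces inclusion to a decidable test.
  same-plane : ∀ o (P Q : Plane s) → support P ≡ support Q → Q ∋ pick o P → ∀ {x} → P ∋ x → Q ∋ x
  same-plane o P Q P≡Q Q∋pick {x} P∋x k
    with P k | Q k | P∋x k | Q∋pick k | support⇒fixed Q P (sym P≡Q) {k}
  ... | _      | nothing | _               | _               | _ = Maybe.nothing
  ... | just a | just b  | Maybe.just a≡x  | Maybe.just b≡a  | _ = Maybe.just (trans b≡a a≡x)
  ... | nothing | just b | _               | _               | f with () ← f (MaybeAny.just _)

  -- One plane for each support

  representative : List (Hyperplane s) → Subset n → Maybe (Plane s)
  representative 𝒜 S with any? (λ A → support (plane A) ≟ˢ S) 𝒜
  ... | yes A∈ = just (plane (proj₁ (find A∈)))
  ... | no _   = nothing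

  representative-just : ∀ {𝒜 S P} → representative 𝒜 S ≡ just P →
    ∃[ A ] (A ∈ˡ 𝒜 × P ≡ plane A × support P ≡ S)
  representative-just {𝒜} {S} rep≡ with any? (λ A → support (plane A) ≟ˢ S) 𝒜
  representative-just refl | yes A∈ = let A , A∈𝒜 , A≡S = find A∈ in A , A∈𝒜 , refl , A≡S

  representative-exists : ∀ {𝒜 A} → A ∈ˡ 𝒜 → ∃[ P ] representative 𝒜 (support (plane A)) ≡ just P
  representative-exists {𝒜} {A} A∈𝒜 with any? (λ B → support (plane B) ≟ˢ support (plane A)) 𝒜
  ... | yes _ = _ , refl
  ... | no ∄  = contradiction (lose A∈𝒜 refl) ∄

  representatives : List (Hyperplane s) → List (Plane s)
  representatives 𝒜 = mapMaybe (representative 𝒜) (subsets n)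

∑-mapMaybe : ∀ (g : A → Maybe B) xs {f : B → ℚ} {f′ : A → ℚ} → (∀ x → 0ℚ ≤ℚ f′ x) →
  (∀ {x y} → g x ≡ just y → f y ≤ℚ f′ x) → ∑ (mapMaybe g xs) f ≤ℚ ∑ xs f′
∑-mapMaybe g []       0≤f′ f≤f′ = ℚₚ.≤-refl
∑-mapMaybe g (x ∷ xs) 0≤f′ f≤f′ with g x in g≡
... | just y  = ℚₚ.+-mono-≤ (f≤f′ g≡) (∑-mapMaybe g xs 0≤f′ f≤f′)
... | nothing = ℚₚ.≤-trans (∑-mapMaybe g xs 0≤f′ f≤f′) (p≤q+p (0≤f′ x))

∈-mapMaybe⁺ : ∀ (g : A → Maybe B) {x y xs} → x ∈ˡ xs → g x ≡ just y → y ∈ˡ mapMaybe g xs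
∈-mapMaybe⁺ g {x} (here refl) g≡ with just _ ← g x | refl ← g≡ = here refl
∈-mapMaybe⁺ g {xs = z ∷ _} (there x∈) g≡ with g z
... | just _  = there (∈-mapMaybe⁺ g x∈ g≡)
... | nothing = ∈-mapMaybe⁺ g x∈ g≡

∈-mapMaybe⁻ : ∀ (g : A → Maybe B) {y} xs → y ∈ˡ mapMaybe g xs → ∃[ x ] g x ≡ just y
∈-mapMaybe⁻ g (x ∷ xs) y∈ with g x in g≡
∈-mapMaybe⁻ g (x ∷ xs) (here refl) | just _  = x , g≡
∈-mapMaybe⁻ g (x ∷ xs) (there y∈)  | just _  = ∈-mapMaybe⁻ g xs y∈
∈-mapMaybe⁻ g (x ∷ xs) y∈          | nothing = ∈-mapMaybe⁻ g xs y∈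

-- By the hypothesis on equal supports, the representative of the support of `A` contains all of
-- `A`.
representative-∋ : ∀ {s : Fin n → ℕ} (o : Point s) {𝒜 : List (Hyperplane s)} →
  (∀ A B → A ∈ˡ 𝒜 → B ∈ˡ 𝒜 → support (plane A) ≡ support (plane B) → plane B ∋ pick o (plane A)) →
  ∀ {A x} → A ∈ˡ 𝒜 → ⟦ A ⟧ x → ∃[ P ] (P ∈ˡ representatives 𝒜 × P ∋ x)
representative-∋ o {𝒜} same {A} A∈𝒜 x∈A with representative-exists A∈𝒜
... | P , rep≡ with representative-just {𝒜 = 𝒜} rep≡
...   | B , B∈𝒜 , refl , B≡A =
  P , ∈-mapMaybe⁺ (representative 𝒜) (∈-subsets (support (plane A))) rep≡ ,
  same-plane o (plane A) (plane B) (sym B≡A) (same A B A∈𝒜 B∈𝒜 (sym B≡A)) (∈⇒∋ {A = A} x∈A)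

-- Each support is represented at most once and weights are nonnegative, so the energy is a partial
-- sum over pairs of subsets.
energy-representatives : ∀ {s : Fin n → ℕ} {c v : Fin n → ℚ} → (∀ i → 0ℚ ≤ℚ c i) → (∀ i → 0ℚ ≤ℚ v i) →
  ∀ (𝒜 : List (Hyperplane s)) → energy c v (representatives 𝒜) ≤ℚ totalWeight c v
energy-representatives {n} {s} {c} {v} 0≤c 0≤v 𝒜 = ℚₚ.≤-trans
  (∑-mapMaybe (representative 𝒜) (subsets n) (λ S → ∑-nonneg (subsets n) (0≤weight 0≤c 0≤v S)) row)
  (ℚₚ.≤-reflexive (∑∑-weight c v))
  where
  row : ∀ {S P} → representative 𝒜 S ≡ just P →
    ∑ (representatives 𝒜) (λ Q → weight c v (support P) (support Q)) ≤ℚ ∑ (subsets n) (weight c v S)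
  row {P = P} rep≡ with representative-just {𝒜 = 𝒜} rep≡
  ... | _ , _ , _ , refl = ∑-mapMaybe (representative 𝒜) (subsets n) (0≤weight 0≤c 0≤v (support P))
    (λ rep≡ → entry (representative-just {𝒜 = 𝒜} rep≡))
    where
    entry : ∀ {P Q : Plane s} {T} → ∃[ A ] (A ∈ˡ 𝒜 × Q ≡ plane A × support Q ≡ T) →
      weight c v (support P) (support Q) ≤ℚ weight c v (support P) T
    entry (_ , _ , _ , refl) = ℚₚ.≤-refl

theorem1p4 : (q : ℕ → ℕ) → (∀ k → 1 ≤ k → 2 ≤ q k) → (+ 3 / 1) <liminf (ratio q) →
    ∃[ C ] (∀ (n : ℕ) (𝒜 : List (Hyperplane (sizes q n))) → Covers 𝒜 →
    (∃[ A ] ∃[ B ] (A ∈ˡ 𝒜 × B ∈ˡ 𝒜 × ¬ (A ≈ B) × Parallel A B))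
    ⊎ (∃[ A ] (A ∈ˡ 𝒜 × F A ⊆ [1‥ C ])))
theorem1p4 q 2≤q (N , r , 3<r , r≤ratio) = C , dichotomy
  where
  q-large : ∀ k → suc N ≤ k → (3 ℕ.* ↧ₙ r ℕ.+ 1) ℕ.* k ≤ q k ℕ.* ↧ₙ r
  -- `ratio q j` concerns coordinate `j + 1`, so a bound from `N` on becomes one from `suc N` on.
  q-large (suc j) N<k = ratio-bound {q} r 3<r (r≤ratio j (ℕₚ.≤-pred N<k))

  open Weights 2≤q {N} {↧ₙ r} (s≤s z≤n) q-large

  dichotomy : ∀ n (𝒜 : List (Hyperplane (sizes q n))) → Covers 𝒜 →
    (∃[ A ] ∃[ B ] (A ∈ˡ 𝒜 × B ∈ˡ 𝒜 × ¬ (A ≈ B) × Parallel A B)) ⊎ (∃[ A ] (A ∈ˡ 𝒜 × F A ⊆ [1‥ C ]))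
  dichotomy n 𝒜 covers = answer
    where
    s = sizes q n

    2≤s : ∀ k → 2 ≤ s k
    2≤s k = 2≤q (index k) (s≤s z≤n)

    origin : Point s
    origin k = fromℕ< (ℕₚ.≤-trans (s≤s z≤n) (2≤s k))

    -- A decidable witness of parallel but different hyperplanes: one chosen point of `A` lies
    -- outside `B`.
    Distinct : Hyperplane s → Hyperplane s → Set
    Distinct A B = support (plane A) ≡ support (plane B) × ¬ (plane B ∋ pick origin (plane A))

    distinct? : ∀ A B → Dec (Distinct A B)
    distinct? A B = (support (plane A) ≟ˢ support (plane B)) ×-dec ¬? (plane B ∋? pick origin (plane A))

    reaches? : ∀ A → Dec (Reaches C (plane A))
    reaches? A = Finₚ.any? (λ k → just? (plane A k) ×-dec (C ℕ.≤? toℕ k))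
      where
      just? : ∀ {m} (a : Maybe (Fin m)) → Dec (Is-just a)
      just? = MaybeAny.dec (λ _ → yes _)

    answer : (∃[ A ] ∃[ B ] (A ∈ˡ 𝒜 × B ∈ˡ 𝒜 × ¬ (A ≈ B) × Parallel A B))
      ⊎ (∃[ A ] (A ∈ˡ 𝒜 × F A ⊆ [1‥ C ]))
    answer with any? (λ A → any? (distinct? A) 𝒜) 𝒜 | any? (λ A → ¬? (reaches? A)) 𝒜
    ... | yes ∃A | _ =
      let A , A∈𝒜 , ∃B = find ∃A
          B , B∈𝒜 , same , B∌ = find ∃B
      in inj₁ (A , B , A∈𝒜 , B∈𝒜 ,
        (λ A≈B → B∌ (∈⇒∋ {A = B} (proj₁ A≈B (∋⇒∈ {A = A} (∋-pick origin (plane A)))))) ,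
        same-support⇒parallel 2≤s A B same)
    ... | no _ | yes ∃A = let A , A∈𝒜 , unreached = find ∃A in
      inj₂ (A , A∈𝒜 , λ {k} k∈F → ℕₚ.≮⇒≥ (λ C<k → unreached (k , F⇒fixed 2≤s A k∈F , ℕₚ.≤-pred C<k)))
    -- Now hyperplanes of equal support coincide, and each fixes a coordinate beyond `C`. The greedy
    -- point misses all representatives, hence all of `𝒜`, against the covering.
    ... | no ∄distinct | no ∄unreached = ⊥-elim (not-avoidable avoiding)
      where
      reaches : ∀ {P} → P ∈ˡ representatives 𝒜 → Reaches C P
      reaches P∈ with ∈-mapMaybe⁻ (representative 𝒜) (subsets n) P∈
      ... | S , rep≡ with representative-just {𝒜 = 𝒜} rep≡
      ...   | A , A∈𝒜 , refl , _ = decidable-stable (reaches? A) (λ ¬reaches → ∄unreached (lose A∈𝒜 ¬reaches))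

      avoiding : ∃[ x ] (∀ {P} → P ∈ˡ representatives 𝒜 → ¬ (P ∋ x))
      -- With `t = 1 - δ` the energy bound `(1 - t)²` is `δ²`.
      avoiding = avoid {C = C} {c = c ∘ index} {v ∘ index} {1ℚ - δ}
        (subst (0ℚ ≤ℚ_) δ≡ 0≤δ) (0≤c ∘ index) (0≤v ∘ index)
        (λ i → c-large (index i) (s≤s z≤n)) (v-large ∘ toℕ) (representatives 𝒜) reaches
        (ℚₚ.≤-trans (energy-representatives (0≤c ∘ index) (0≤v ∘ index) 𝒜)
          (ℚₚ.≤-trans (ℚₚ.≤-reflexive (totalWeight≡total {n} {c} {v} 1 (λ _ → refl) (λ _ → refl)))
            (subst (λ δ′ → total c v 1 n ≤ℚ δ′ * δ′) δ≡ (total-small n))))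
        where
        δ≡ : δ ≡ 1ℚ - (1ℚ - δ)
        δ≡ = solve 1 (λ δ → δ := con 1ℚ :- (con 1ℚ :- δ)) refl δ

      not-avoidable : ¬ (∃[ x ] (∀ {P} → P ∈ˡ representatives 𝒜 → ¬ (P ∋ x)))
      not-avoidable (x , avoids) with find (covers x)
      ... | A , A∈𝒜 , x∈A =
        let P , P∈ , P∋x = representative-∋ origin
              (λ A B A∈𝒜 B∈𝒜 A≡B → decidable-stable (plane B ∋? pick origin (plane A))
                (λ B∌ → ∄distinct (lose A∈𝒜 (lose B∈𝒜 (A≡B , B∌)))))
              A∈𝒜 x∈A
        in avoids P∈ P∋x
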